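{- Let $\mu$ be an inductive valuation on $K(x)$ and let $$\mu_0\xrightarrow{(\phi_1,\lambda_1)}\mu_1\xrightarrow{(\phi_2,\lambda_2)}\cdots\xrightarrow{(\phi_r,\lambda_r)}\mu_r=\mu$$ be an optimal MacLane chain of $\mu$. Then $[\phi_1,\dots,\phi_r]$ is an Okutsu frame of every strong key polynomial $F$ for $\mu$, and $C_i(F)=C_i(\mu)$ for all $1\le i\le r$.
   Context: **Valuations.** $K$ is a field with a discrete valuation $v\colon K^*\to\mathbb{Z}$, $v(K^*)=\mathbb{Z}$, valuation ring $\mathcal{O}$. $K_v$ is the completion, $\mathcal{O}_v$ its valuation ring, and $v$ also denotes its canonical extension to a fixed algebraic closure $\overline{K}_v$, $v\colon\overline K_v\to\mathbb{Q}\cup\{\infty\}$. $\mathbb{V}$ is the set of discrete valuations $\mu\colon K(x)^*\to\mathbb{Q}$ with $\mu|_K=v$, $\mu(x)\ge0$; put $\mu(0)=\infty$, $\Gamma(\mu)=\mu(K(x)^*)$. $\mu_0\in\mathbb{V}$ is given by $\mu_0(\sum_s a_sx^s)=\min_s v(a_s)$. **Graded algebra.** For $\alpha\in\Gamma(\mu)$, $\mathcal P_\alpha=\{g\in K[x]:\mu(g)\ge\alpha\}$, $\mathcal P_\alpha^+=\{g\in K[x]:\mu(g)>\alpha\}$, $\mathcal{G}r(\mu)=\bigoplus_{\alpha}\mathcal P_\alpha/\mathcal P_\alpha^+$, $H_\mu(0)=0$ and $H_\mu(g)=g+\mathcal P^+_{\mu(g)}$ for $g\ne0$; $h\mid_\mu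 g$ means that $H_\mu(h)$ divides $H_\mu(g)$ in $\mathcal{G}r(\mu)$. **Key polynomials, chains.** A key polynomial for $\mu$ is a monic $\phi\in K[x]$ of positive degree such that $H_\mu(\phi)\mathcal{G}r(\mu)$ is a non-zero prime ideal and $\phi\nmid_\mu g$ for all non-zero $g$ with $\deg g<\deg\phi$. (Key polynomials lie in $\mathcal{O}[x]$ and are irreducible in $K_v[x]$.) For such $\phi$ and $\lambda\in\mathbb{Q}_{>0}$, $[\mu;(\phi,\lambda)]\in\mathbb V$ is the valuation $\sum_s g_s\phi^s\mapsto\min_s\{\mu(g_s\phi^s)+s\lambda\}$ on $\phi$-expansions ($\deg g_s<\deg\phi$). A valuation $\mu$ is inductive if it is obtained from $\mu_0$ by finitely many augmentations $\mu_i=[\mu_{i-1};(\phi_i,\lambda_i)]$, with $\phi_i$ a key polynomial for $\mu_{i-1}$ and $\lambda_i\in\mathbb{Q}_{>0}$; the chain is an optimal MacLane chain if $\deg\phi_1<\cdots<\deg\phi_r$. All optimal MacLane chains of $\mu$ have the same length $r$ (the depth of $\mu$) and the same $m_r(\mu):=\deg\phi_r$ and $C_i(\mu):=\mu_i(\phi_i)/\deg\phi_i$ ($1\le i\le r$). A key polynomial $\phi$ for $\mu$ is strong if $r=0$ or $\deg\phi>m_r(\mu)$. **Okutsu frames.** A prime polynomial is a monic irreducible polynomial in $\mathcal{O}_v[x]$. Let $F$ be a prime polynomial with root $\theta\in\overline K_v$. Let $F_1,\dots,F_r\in\mathcal{O}[x]$ be monic with $1\le\deg F_1<\cdots<\deg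 F_r<\deg F$; put $F_{r+1}=F$, $C_0=0$, $C_i=v(F_i(\theta))/\deg F_i$ for $1\le i\le r+1$ (so $C_{r+1}=\infty$). $[F_1,\dots,F_r]$ is an Okutsu frame of $F$ if for all $0\le i\le r$ one has $C_i<C_{i+1}$ and every monic $g\in\mathcal{O}[x]$ of positive degree with $\deg g<\deg F_{i+1}$ satisfies $v(g(\theta))/\deg g\le C_i$. The length $r$ and the constants $C_i(F):=C_i$ do not depend on the choice of the Okutsu frame of $F$. -}

module Defs where

open import Level using (Level; _⊔_) renaming (suc to lsuc)
open import Algebra.Bundles using (CommutativeRing; RawRing; RawSemiring)
open import Algebra.Morphism.Structures using (module RingMorphisms)
import Algebra.Morphism.Construct.Identity as Identity
import Algebra.Definitions.RawSemiring as RawSemiringDefs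
open import Data.Bool.Base using (if_then_else_)
open import Data.Fin.Base as Fin using (Fin; zero; suc; inject₁; fromℕ)
open import Data.Integer.Base as ℤ using (ℤ; +_)
open import Data.List.Base as List using (List; []; _∷_; foldr; _++_; cartesianProductWith)
open import Data.List.Relation.Unary.All using (All)
open import Data.Nat.Base as ℕ using (ℕ; zero; suc; NonZero)
open import Data.Product.Base using (∃; ∃-syntax; _×_; _,_)
open import Data.Rational.Base as ℚ using (ℚ; 0ℚ; 1ℚ)
open import Data.Rational.Properties as ℚₚ using (_≟_)
open import Data.Unit.Base using (⊤)
open import Data.Vec.Base as Vec using (Vec; lookup; last; _∷ʳ_)
open import Relation.Binary.PropositionalEquality as ≡ using (_≡_; refl)
open import Relation.Nullary using (¬_; does; contradiction)
open import Relation.Nullary.Construct.Add.Supremum public using (_⁺; ⊤⁺; [_])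
open import Relation.Binary.Construct.Add.Supremum.NonStrict ℚ._≤_ public using (_≤⁺_)
  renaming ([_] to [_]≤; _≤⊤⁺ to _≤⊤)
open import Relation.Binary.Construct.Add.Supremum.Strict ℚ._<_ public using (_<⁺_)
  renaming ([_] to [_]<; [_]<⊤⁺ to [_]<⊤)
import Relation.Binary.Reasoning.Setoid as SetoidReasoning

------------------------------------------------------------------------

ℚ∞ : Set
ℚ∞ = ℚ ⁺

pattern ∞ = ⊤⁺

infixl 7 _⊓∞_ _/∞_
infixl 6 _+∞_

_+∞_ : ℚ∞ → ℚ∞ → ℚ∞
[ p ] +∞ [ q ] = [ p ℚ.+ q ]
[ _ ] +∞ ∞     = ∞
∞     +∞ _     = ∞

_⊓∞_ : ℚ∞ → ℚ∞ → ℚ∞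
[ p ] ⊓∞ [ q ] = [ p ℚ.⊓ q ]
[ p ] ⊓∞ ∞     = [ p ]
∞     ⊓∞ q     = q

_/∞_ : ℚ∞ → (d : ℕ) .{{_ : NonZero d}} → ℚ∞
[ p ] /∞ d = [ p ℚ.* (+ 1 ℚ./ d) ]
∞     /∞ d = ∞

------------------------------------------------------------------------

record Field c ℓ : Set (lsuc (c ⊔ ℓ)) where
  field
    commutativeRing : CommutativeRing c ℓ
  open CommutativeRing commutativeRing public
  field
    1≉0        : 1# ≉ 0#
    invertible : ∀ a → a ≉ 0# → ∃[ b ] a * b ≈ 1#

record FieldHom {c ℓ} (K L : Field c ℓ) : Set (c ⊔ ℓ) where
  private
    module K = Field K
    module L = Field L
  field
    ⟦_⟧               : K.Carrier → L.Carrier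
    isRingHomomorphism : RingMorphisms.IsRingHomomorphism K.rawRing L.rawRing ⟦_⟧
  open RingMorphisms.IsRingHomomorphism isRingHomomorphism public

-- The value at 0 is ∞ and values at non-zero elements are rational.  As val is
-- a function into ℚ∞, a valued field has decidable equality.
record Valuation {c ℓ} (K : Field c ℓ) : Set (c ⊔ ℓ) where
  open Field K hiding (refl)
  field
    val      : Carrier → ℚ∞
    val-cong : ∀ {a b} → a ≈ b → val a ≡ val b
    val-0    : val 0# ≡ ∞
    val-∞    : ∀ {a} → val a ≡ ∞ → a ≈ 0#
    val-*    : ∀ a b → val (a * b) ≡ val a +∞ val b
    val-+    : ∀ a b → val a ⊓∞ val b ≤⁺ val (a + b)

  InValueGroup : ℚ → Set c
  InValueGroup α = ∃[ a ] val a ≡ [ α ]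

  -- The value group is ℤγ.
  ValueGroupGeneratedBy : ℚ → Set c
  ValueGroupGeneratedBy γ =
    InValueGroup γ × (∀ α → InValueGroup α → ∃[ k ] α ≡ (k ℚ./ 1) ℚ.* γ)

  IsDiscrete : Set c
  IsDiscrete = ∃[ γ ] 0ℚ ℚ.< γ × ValueGroupGeneratedBy γ

  Integral : Carrier → Set
  Integral a = [ 0ℚ ] ≤⁺ val a

  val-1 : val 1# ≡ [ 0ℚ ]
  val-1 = idem (val 1#) (λ e → 1≉0 (val-∞ e))
               (≡.trans (val-cong (sym (*-identityˡ 1#))) (val-* 1# 1#))
    where
    idem : ∀ γ → ¬ γ ≡ ∞ → γ ≡ γ +∞ γ → γ ≡ [ 0ℚ ]
    idem ∞     γ≢∞ _ = contradiction refl γ≢∞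
    idem [ p ] _   e = ≡.cong [_] (+-cancel p (fromJust e))
      where
      fromJust : ∀ {p q} → [ p ] ≡ [ q ] → p ≡ q
      fromJust refl = refl
      +-cancel : ∀ p → p ≡ p ℚ.+ p → p ≡ 0ℚ
      +-cancel p e = begin
        p                          ≡⟨ ℚₚ.+-identityʳ p ⟨
        p ℚ.+ 0ℚ                   ≡⟨ ≡.cong (p ℚ.+_) (ℚₚ.+-inverseʳ p) ⟨
        p ℚ.+ (p ℚ.- p)            ≡⟨ ℚₚ.+-assoc p p (ℚ.- p) ⟨
        p ℚ.+ p ℚ.- p              ≡⟨ ≡.cong (ℚ._- p) e ⟨
        p ℚ.- p                    ≡⟨ ℚₚ.+-inverseʳ p ⟩
        0ℚ                         ∎
        where open ≡.≡-Reasoning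

------------------------------------------------------------------------
-- Polynomials, as lists of coefficients starting with the constant one.
-- Trailing zeros are allowed: equality is equality of all coefficients.

module Polynomial {c ℓ} (K : Field c ℓ) where
  open Field K

  Poly : Set c
  Poly = List Carrier

  coeff : Poly → ℕ → Carrier
  coeff []      _       = 0#
  coeff (a ∷ _) zero    = a
  coeff (_ ∷ p) (suc n) = coeff p n

  infix  4 _≈ₚ_
  infixl 6 _+ₚ_
  infixl 7 _*ₚ_

  _≈ₚ_ : Poly → Poly → Set ℓ
  p ≈ₚ q = ∀ n → coeff p n ≈ coeff q n

  _+ₚ_ : Poly → Poly → Poly
  []      +ₚ q       = q
  (a ∷ p) +ₚ []      = a ∷ p
  (a ∷ p) +ₚ (b ∷ q) = a + b ∷ p +ₚ q

  -ₚ_ : Poly → Poly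
  -ₚ_ = List.map (-_)

  scale : Carrier → Poly → Poly
  scale a = List.map (a *_)

  _*ₚ_ : Poly → Poly → Poly
  []      *ₚ q = []
  (a ∷ p) *ₚ q = scale a q +ₚ (0# ∷ p *ₚ q)

  polyRawRing : RawRing c ℓ
  polyRawRing = record
    { Carrier = Poly
    ; _≈_ = _≈ₚ_
    ; _+_ = _+ₚ_
    ; _*_ = _*ₚ_
    ; -_  = -ₚ_
    ; 0#  = []
    ; 1#  = 1# ∷ []
    }

  open RawRing polyRawRing public using () renaming (_≉_ to _≉ₚ_; 0# to 0ₚ; 1# to 1ₚ)
  open RawSemiringDefs (RawRing.rawSemiring polyRawRing) public
    using (Irreducible) renaming (_^_ to _^ₚ_)

  -- For non-zero g this says deg g < d.
  DegreeBelow : ℕ → Poly → Set ℓ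
  DegreeBelow d g = ∀ n → d ℕ.≤ n → coeff g n ≈ 0#

  -- Positive degree is part of the type.
  record MonicPoly : Set (c ⊔ ℓ) where
    field
      poly         : Poly
      degree       : ℕ
      degree≢0     : NonZero degree
      coeff-degree : coeff poly degree ≈ 1#
      coeff-above  : DegreeBelow (suc degree) poly

  open MonicPoly public

  infixl 7 _/deg_
  _/deg_ : ℚ∞ → MonicPoly → ℚ∞
  γ /deg f = _/∞_ γ (degree f) {{degree≢0 f}}

open Polynomial public using (Poly; MonicPoly)

module _ {c ℓ} {K L : Field c ℓ} (ι : FieldHom K L) where
  private
    module K = Field K
    module L = Field L
    module Kₚ = Polynomial K
    module Lₚ = Polynomial L
    module ι = FieldHom ι

  mapPoly : Poly K → Poly L
  mapPoly = List.map ι.⟦_⟧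

  coeff-map : ∀ p n → Lₚ.coeff (mapPoly p) n L.≈ ι.⟦ Kₚ.coeff p n ⟧
  coeff-map []      n       = L.sym ι.0#-homo
  coeff-map (a ∷ p) zero    = L.refl
  coeff-map (a ∷ p) (suc n) = coeff-map p n

  mapMonic : MonicPoly K → MonicPoly L
  mapMonic f = record
    { poly         = mapPoly (Kₚ.poly f)
    ; degree       = Kₚ.degree f
    ; degree≢0     = Kₚ.degree≢0 f
    ; coeff-degree = L.trans (coeff-map (Kₚ.poly f) (Kₚ.degree f))
                       (L.trans (ι.⟦⟧-cong (Kₚ.coeff-degree f)) ι.1#-homo)
    ; coeff-above  = λ n d<n → L.trans (coeff-map (Kₚ.poly f) n)
                       (L.trans (ι.⟦⟧-cong (Kₚ.coeff-above f n d<n)) ι.0#-homo)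
    }

  eval : Poly K → L.Carrier → L.Carrier
  eval p y = foldr (λ a acc → ι.⟦ a ⟧ L.+ y L.* acc) L.0# p

  private
    open module ≈-Reasoning = SetoidReasoning L.setoid

  eval-+ : ∀ p q y → eval (p Kₚ.+ₚ q) y L.≈ eval p y L.+ eval q y
  eval-+ []      q       y = L.sym (L.+-identityˡ _)
  eval-+ (a ∷ p) []      y = L.sym (L.+-identityʳ _)
  eval-+ (a ∷ p) (b ∷ q) y = begin
    ι.⟦ a K.+ b ⟧ L.+ y L.* eval (p Kₚ.+ₚ q) y
      ≈⟨ L.+-cong (ι.+-homo a b) (L.trans (L.*-congˡ (eval-+ p q y)) (L.distribˡ _ _ _)) ⟩
    (A L.+ B) L.+ (P L.+ Q)   ≈⟨ L.+-assoc A B _ ⟩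
    A L.+ (B L.+ (P L.+ Q))   ≈⟨ L.+-congˡ (L.sym (L.+-assoc B P Q)) ⟩
    A L.+ ((B L.+ P) L.+ Q)   ≈⟨ L.+-congˡ (L.+-congʳ (L.+-comm B P)) ⟩
    A L.+ ((P L.+ B) L.+ Q)   ≈⟨ L.+-congˡ (L.+-assoc P B Q) ⟩
    A L.+ (P L.+ (B L.+ Q))   ≈⟨ L.sym (L.+-assoc A P _) ⟩
    (A L.+ P) L.+ (B L.+ Q)   ∎
    where
    A = ι.⟦ a ⟧
    B = ι.⟦ b ⟧
    P = y L.* eval p y
    Q = y L.* eval q y

  eval-scale : ∀ a q y → eval (Kₚ.scale a q) y L.≈ ι.⟦ a ⟧ L.* eval q y
  eval-scale a []      y = L.sym (L.zeroʳ _)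
  eval-scale a (b ∷ q) y = begin
    ι.⟦ a K.* b ⟧ L.+ y L.* eval (Kₚ.scale a q) y
      ≈⟨ L.+-cong (ι.*-homo a b) (L.*-congˡ (eval-scale a q y)) ⟩
    A L.* B L.+ y L.* (A L.* Q)   ≈⟨ L.+-congˡ (L.sym (L.*-assoc y A Q)) ⟩
    A L.* B L.+ (y L.* A) L.* Q   ≈⟨ L.+-congˡ (L.*-congʳ (L.*-comm y A)) ⟩
    A L.* B L.+ (A L.* y) L.* Q   ≈⟨ L.+-congˡ (L.*-assoc A y Q) ⟩
    A L.* B L.+ A L.* (y L.* Q)   ≈⟨ L.sym (L.distribˡ A B _) ⟩
    A L.* (B L.+ y L.* Q)         ∎
    where
    A = ι.⟦ a ⟧
    B = ι.⟦ b ⟧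
    Q = eval q y

  eval-* : ∀ p q y → eval (p Kₚ.*ₚ q) y L.≈ eval p y L.* eval q y
  eval-* []      q y = L.sym (L.zeroˡ _)
  eval-* (a ∷ p) q y = begin
    eval (Kₚ.scale a q Kₚ.+ₚ (K.0# ∷ p Kₚ.*ₚ q)) y
      ≈⟨ eval-+ (Kₚ.scale a q) (K.0# ∷ p Kₚ.*ₚ q) y ⟩
    eval (Kₚ.scale a q) y L.+ (ι.⟦ K.0# ⟧ L.+ y L.* eval (p Kₚ.*ₚ q) y)
      ≈⟨ L.+-cong (eval-scale a q y)
           (L.trans (L.+-cong ι.0#-homo (L.*-congˡ (eval-* p q y))) (L.+-identityˡ _)) ⟩
    A L.* Q L.+ y L.* (P L.* Q)   ≈⟨ L.+-congˡ (L.sym (L.*-assoc y P Q)) ⟩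
    A L.* Q L.+ (y L.* P) L.* Q   ≈⟨ L.sym (L.distribʳ Q A _) ⟩
    (A L.+ y L.* P) L.* Q         ∎
    where
    A = ι.⟦ a ⟧
    P = eval p y
    Q = eval q y

  eval-1 : ∀ y → eval Kₚ.1ₚ y L.≈ L.1#
  eval-1 y = L.trans (L.+-cong ι.1#-homo (L.zeroʳ y)) (L.+-identityʳ L.1#)

  IsRoot : Poly K → L.Carrier → Set ℓ
  IsRoot p y = eval p y L.≈ L.0#

  Extends : Valuation L → Valuation K → Set c
  Extends w v = ∀ a → Valuation.val w ι.⟦ a ⟧ ≡ Valuation.val v a

------------------------------------------------------------------------
-- Completion, algebraic closure and rational function field of a field,
-- described up to isomorphism.

module _ {c ℓ} {K : Field c ℓ} (w : Valuation K) where
  open Field K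
  open Valuation w

  IsCauchy : (ℕ → Carrier) → Set
  IsCauchy s = ∀ (B : ℚ) → ∃[ N ] ∀ m n → N ℕ.≤ m → N ℕ.≤ n → [ B ] ≤⁺ val (s m - s n)

  _ConvergesTo_ : (ℕ → Carrier) → Carrier → Set
  s ConvergesTo a = ∀ (B : ℚ) → ∃[ N ] ∀ n → N ℕ.≤ n → [ B ] ≤⁺ val (s n - a)

record IsCompletion {c ℓ} {K K̂ : Field c ℓ} (ι : FieldHom K K̂)
                    (v : Valuation K) (v̂ : Valuation K̂) : Set (c ⊔ ℓ) where
  open Field K̂ using (Carrier; _-_)
  open FieldHom ι using (⟦_⟧)
  field
    extends  : Extends ι v̂ v
    dense    : ∀ (b : Carrier) (B : ℚ) → ∃[ a ] [ B ] ≤⁺ Valuation.val v̂ (b - ⟦ a ⟧)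
    complete : ∀ (s : ℕ → Carrier) → IsCauchy v̂ s → ∃[ b ] _ConvergesTo_ v̂ s b

idHom : ∀ {c ℓ} (K : Field c ℓ) → FieldHom K K
idHom K = record { isRingHomomorphism = Identity.isRingHomomorphism (Field.rawRing K) (Field.refl K) }

record IsAlgebraicClosure {c ℓ} {K L : Field c ℓ} (ι : FieldHom K L) : Set (c ⊔ ℓ) where
  open Polynomial using (poly)
  field
    algebraic : ∀ y → ∃ λ (f : MonicPoly K) → IsRoot ι (poly f) y
    closed    : ∀ (f : MonicPoly L) → ∃[ y ] IsRoot (idHom L) (poly f) y

-- E = K(x) with x transcendental over K.
record IsRationalFunctionField {c ℓ} {K E : Field c ℓ}
                               (ι : FieldHom K E) (x : Field.Carrier E) : Set (c ⊔ ℓ) where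
  open Polynomial K using (_≈ₚ_; _≉ₚ_; 0ₚ)
  open Field E using (_≈_; _*_)
  field
    transcendental : ∀ p → IsRoot ι p x → p ≈ₚ 0ₚ
    generated      : ∀ f → ∃[ p ] ∃[ q ] q ≉ₚ 0ₚ × f * eval ι q x ≈ eval ι p x

------------------------------------------------------------------------

-- K̂ is the completion of (K, v), K̄ an algebraic closure of K̂ (not of K), and
-- v̄ the extension of v̂ to K̄, which is unique by completeness.
record Setting c ℓ : Set (lsuc (c ⊔ ℓ)) where
  field
    K      : Field c ℓ
    v      : Valuation K
    v-onto : Valuation.ValueGroupGeneratedBy v 1ℚ

    K̂            : Field c ℓ
    v̂            : Valuation K̂
    ι̂            : FieldHom K K̂
    isCompletion : IsCompletion ι̂ v v̂

    K̄                  : Field c ℓ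
    v̄                  : Valuation K̄
    ῑ                  : FieldHom K̂ K̄
    isAlgebraicClosure : IsAlgebraicClosure ῑ
    v̄-extends          : Extends ῑ v̄ v̂

    K⟨x⟩                    : Field c ℓ
    x                       : Field.Carrier K⟨x⟩
    ιₓ                      : FieldHom K K⟨x⟩
    isRationalFunctionField : IsRationalFunctionField ιₓ x

module Theory {c ℓ} (S : Setting c ℓ) where
  open Setting S public
  open Valuation using (val)
  open Polynomial K hiding (Poly; MonicPoly)

  IntegralPoly : Poly K → Set
  IntegralPoly g = ∀ n → Valuation.Integral v (coeff g n)

  minCoeffVal : Poly K → ℚ∞
  minCoeffVal = foldr (λ a m → val v a ⊓∞ m) ∞

  record 𝕍 : Set (c ⊔ ℓ) where
    field
      valuation  : Valuation K⟨x⟩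
      restricts  : Extends ιₓ valuation v
      discrete   : Valuation.IsDiscrete valuation
      x-integral : Valuation.Integral valuation x

    _⟪_⟫ : Poly K → ℚ∞
    _⟪_⟫ g = val valuation (eval ιₓ g x)

  open 𝕍 public

  IsGauss : 𝕍 → Set c
  IsGauss μ = ∀ g → μ ⟪ g ⟫ ≡ minCoeffVal g

  ----------------------------------------------------------------------

  module GradedAlgebra (μ : 𝕍) where
    open Valuation (valuation μ) using (InValueGroup; val-cong; val-*; val-1)

    -- A representative g ∈ 𝒫_α of a class in 𝒫_α / 𝒫_α⁺.
    record Homogeneous : Set c where
      field
        grade     : ℚ
        grade∈Γ   : InValueGroup grade
        rep       : Poly K
        rep∈𝒫     : [ grade ] ≤⁺ μ ⟪ rep ⟫

    open Homogeneous public

    -- A finite formal sum of homogeneous elements, in which grades may repeat.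
    Gr : Set c
    Gr = List Homogeneous

    component : ℚ → Gr → Poly K
    component α = foldr (λ h g → if does (grade h ≟ α) then rep h +ₚ g else g) 0ₚ

    -- The components of grade α agree modulo 𝒫_α⁺, for all α.  For α ∉ Γ(μ)
    -- both components are empty sums.
    _≈ᴳ_ : Gr → Gr → Set
    a ≈ᴳ b = ∀ α → [ α ] <⁺ μ ⟪ component α a +ₚ -ₚ component α b ⟫

    ⟪⟫-* : ∀ g h → μ ⟪ g *ₚ h ⟫ ≡ μ ⟪ g ⟫ +∞ μ ⟪ h ⟫
    ⟪⟫-* g h = ≡.trans (val-cong (eval-* ιₓ g h x)) (val-* _ _)

    ≤⁺-+∞ : ∀ {α β γ δ} → [ α ] ≤⁺ γ → [ β ] ≤⁺ δ → [ α ℚ.+ β ] ≤⁺ (γ +∞ δ)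
    ≤⁺-+∞ [ p ]≤ [ q ]≤ = [ ℚₚ.+-mono-≤ p q ]≤
    ≤⁺-+∞ [ p ]≤ (_ ≤⊤) = _ ≤⊤
    ≤⁺-+∞ (_ ≤⊤) _      = _ ≤⊤

    _*ʰ_ : Homogeneous → Homogeneous → Homogeneous
    a *ʰ b = record
      { grade   = grade a ℚ.+ grade b
      ; grade∈Γ = let (f , ef) = grade∈Γ a ; (g , eg) = grade∈Γ b in
                  Field._*_ K⟨x⟩ f g , ≡.trans (val-* f g) (≡.cong₂ _+∞_ ef eg)
      ; rep     = rep a *ₚ rep b
      ; rep∈𝒫   = ≡.subst ([ grade a ℚ.+ grade b ] ≤⁺_) (≡.sym (⟪⟫-* (rep a) (rep b)))
                    (≤⁺-+∞ (rep∈𝒫 a) (rep∈𝒫 b))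
      }

    1ʰ : Homogeneous
    1ʰ = record
      { grade   = 0ℚ
      ; grade∈Γ = Field.1# K⟨x⟩ , val-1
      ; rep     = 1ₚ
      ; rep∈𝒫   = ≡.subst ([ 0ℚ ] ≤⁺_) (≡.sym (≡.trans (val-cong (eval-1 ιₓ x)) val-1))
                    [ ℚₚ.≤-refl ]≤
      }

    grRawSemiring : RawSemiring c _
    grRawSemiring = record
      { Carrier = Gr
      ; _≈_ = _≈ᴳ_
      ; _+_ = _++_
      ; _*_ = cartesianProductWith _*ʰ_
      ; 0#  = []
      ; 1#  = 1ʰ ∷ []
      }

    open RawSemiringDefs grRawSemiring public using (Prime; _∣_)

    -- By cases on γ = μ(g), so that H(0) = 0.
    initial : ∀ g γ → μ ⟪ g ⟫ ≡ γ → Gr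
    initial g ∞     _ = []
    initial g [ α ] e = record
      { grade   = α
      ; grade∈Γ = eval ιₓ g x , e
      ; rep     = g
      ; rep∈𝒫   = ≡.subst ([ α ] ≤⁺_) (≡.sym e) [ ℚₚ.≤-refl ]≤
      } ∷ []

    H : Poly K → Gr
    H g = initial g (μ ⟪ g ⟫) refl

    _∣μ_ : Poly K → Poly K → Set c
    h ∣μ g = H h ∣ H g

  ----------------------------------------------------------------------

  record IsKeyPolynomial (μ : 𝕍) (φ : MonicPoly K) : Set (c ⊔ ℓ) where
    open GradedAlgebra μ using (Prime; H; _∣μ_)
    field
      -- A prime element is exactly a generator of a non-zero prime ideal.
      prime   : Prime (H (poly φ))
      minimal : ∀ g → g ≉ₚ 0ₚ → DegreeBelow (degree φ) g → ¬ (poly φ ∣μ g)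

  -- fromExpansion φ s [g₀, g₁, …] = g₀ φˢ + g₁ φˢ⁺¹ + ⋯
  fromExpansion : Poly K → ℕ → List (Poly K) → Poly K
  fromExpansion φ s []       = 0ₚ
  fromExpansion φ s (g ∷ gs) = g *ₚ φ ^ₚ s +ₚ fromExpansion φ (suc s) gs

  -- The minimum of μ(g₀ φˢ) + s λ, μ(g₁ φˢ⁺¹) + (s + 1) λ, …
  augmentedVal : 𝕍 → Poly K → ℚ → ℕ → List (Poly K) → ℚ∞
  augmentedVal μ φ λ′ s []       = ∞
  augmentedVal μ φ λ′ s (g ∷ gs) =
    (μ ⟪ g *ₚ φ ^ₚ s ⟫ +∞ [ (+ s ℚ./ 1) ℚ.* λ′ ]) ⊓∞ augmentedVal μ φ λ′ (suc s) gs

  -- μ′ = [μ; (φ, λ)].  The equation determines μ′ on K[x], hence on K(x).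
  IsAugmentation : 𝕍 → MonicPoly K → ℚ → 𝕍 → Set (c ⊔ ℓ)
  IsAugmentation μ φ λ′ μ′ = ∀ gs → All (DegreeBelow (degree φ)) gs →
    μ′ ⟪ fromExpansion (poly φ) 0 gs ⟫ ≡ augmentedVal μ (poly φ) λ′ 0 gs

  -- Such a chain is what makes μ inductive.  Indices are shifted: φᵢ and λᵢ are
  -- the entries i - 1 of φs and λs, while μᵢ is μs i.
  record MacLaneChain (μ : 𝕍) (r : ℕ) : Set (c ⊔ ℓ) where
    field
      μs         : Fin (suc r) → 𝕍
      φs         : Vec (MonicPoly K) r
      λs         : Vec ℚ r
      start      : IsGauss (μs zero)
      key        : ∀ i → IsKeyPolynomial (μs (inject₁ i)) (lookup φs i)
      λ-positive : ∀ i → 0ℚ ℚ.< lookup λs i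
      augment    : ∀ i → IsAugmentation (μs (inject₁ i)) (lookup φs i) (lookup λs i) (μs (suc i))
      finish     : ∀ f → val (valuation (μs (fromℕ r))) f ≡ val (valuation μ) f

    IsOptimal : Set
    IsOptimal = ∀ i j → i Fin.< j → degree (lookup φs i) ℕ.< degree (lookup φs j)

    -- Cμ i = C_{i+1}(μ) when the chain is optimal.
    Cμ : Fin r → ℚ∞
    Cμ i = μs (suc i) ⟪ poly (lookup φs i) ⟫ /deg lookup φs i

  open MacLaneChain public

  -- Meant for an optimal chain of μ and a key polynomial F for μ.
  IsStrong : ∀ {μ r} → MacLaneChain μ r → MonicPoly K → Set
  IsStrong {r = zero}  chain F = ⊤
  IsStrong {r = suc _} chain F = degree (last (φs chain)) ℕ.< degree F

  ----------------------------------------------------------------------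

  private
    module K̂ₚ = Polynomial K̂

  -- Irreducibility is over K̂; for monic integral polynomials this is the same
  -- as irreducibility over the valuation ring of K̂.
  record IsPrimePoly (F : MonicPoly K̂) : Set (c ⊔ ℓ) where
    field
      integral    : ∀ n → Valuation.Integral v̂ (K̂ₚ.coeff (K̂ₚ.poly F) n)
      irreducible : K̂ₚ.Irreducible (K̂ₚ.poly F)

  valAt : Field.Carrier K̄ → Poly K̂ → ℚ∞
  valAt θ g = val v̄ (eval ῑ g θ)

  -- F₁, …, F_r, F_{r+1} = F
  frameSeq : ∀ {r} → Vec (MonicPoly K) r → MonicPoly K̂ → Fin (suc r) → MonicPoly K̂
  frameSeq Fs F = lookup (Vec.map (mapMonic ι̂) Fs ∷ʳ F)

  -- C₀, …, C_{r+1}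
  okutsuC : ∀ {r} → Vec (MonicPoly K) r → MonicPoly K̂ → Field.Carrier K̄ → Fin (suc (suc r)) → ℚ∞
  okutsuC Fs F θ zero    = [ 0ℚ ]
  okutsuC Fs F θ (suc j) = valAt θ (K̂ₚ.poly Fⱼ) K̂ₚ./deg Fⱼ
    where Fⱼ = frameSeq Fs F j

  -- "A root θ of F" is read as "every root θ of F in K̄".
  record IsOkutsuFrame {r} (Fs : Vec (MonicPoly K) r) (F : MonicPoly K̂) : Set (c ⊔ ℓ) where
    field
      F-prime    : IsPrimePoly F
      integral   : ∀ i → IntegralPoly (poly (lookup Fs i))
      increasing : ∀ i j → i Fin.< j →
                   K̂ₚ.degree (frameSeq Fs F i) ℕ.< K̂ₚ.degree (frameSeq Fs F j)
      C-strict   : ∀ θ → IsRoot ῑ (K̂ₚ.poly F) θ →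
                   ∀ i → okutsuC Fs F θ (inject₁ i) <⁺ okutsuC Fs F θ (suc i)
      C-bound    : ∀ θ → IsRoot ῑ (K̂ₚ.poly F) θ →
                   ∀ i (g : MonicPoly K) → IntegralPoly (poly g) →
                   degree g ℕ.< K̂ₚ.degree (frameSeq Fs F i) →
                   (valAt θ (mapPoly ι̂ (poly g)) /deg g) ≤⁺ okutsuC Fs F θ (inject₁ i)

{-# OPTIONS --safe #-}

-- Let θ be a root of F and w(g) = v(g(θ)).  Write φᵢ also for x when i = 0, and
-- for F when i = r + 1.
--
-- If in every division g = q φ + a by a monic φ the remainder satisfies
-- μ(a) ≥ μ(g), then φ has the largest slope μ(f) / deg f among all monic f:
-- compare the powers f ^ deg φ and φ ^ deg f.  This applies to φᵢ and to φᵢ₊₁ at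
-- μᵢ, so that both have the slope Cᵢ there.  Descending along the chain, F has
-- the slope Cᵢ at every μᵢ.  If w(φᵢ) were less than μᵢ(φᵢ), then φᵢ ^ deg F
-- would dominate F ^ deg φᵢ at θ, contradicting F(θ) = 0; hence μᵢ ≤ w for all i.
-- As w(φᵢ₊₁) > μᵢ(φᵢ₊₁), primality of the initial form of φᵢ₊₁ forces w = μᵢ in
-- degrees less than deg φᵢ₊₁, which gives all the (in)equalities of an Okutsu
-- frame.
--
-- F is irreducible over K̂ because a monic polynomial of K[x] near a proper factor
-- of F would have an arbitrarily large value at a root of that factor, whereas
-- w = μ is bounded on monic polynomials of degree less than deg F.

module Submission where

open import Defs
open import Level using (_⊔_)
open import Algebra.Bundles using (CommutativeRing; RawRing)
import Algebra.Definitions.RawSemiring as RawSemiringDefinitions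
import Algebra.Morphism.Construct.Composition as Composition
import Algebra.Morphism.RingMonomorphism as RingMonomorphism
open import Algebra.Morphism.Structures using (module RingMorphisms)
import Algebra.Properties.Ring as RingProperties
open import Data.Fin.Base as Fin using (Fin; zero; suc; inject₁; fromℕ)
open import Data.Fin.Induction using (<-weakInduction; >-weakInduction)
import Data.Fin.Properties as Finₚ
open import Data.Fin.Relation.Unary.Top using (view; ‵fromℕ; ‵inject₁)
open import Data.Integer.Base as ℤ using (+_)
import Data.Integer.Properties as ℤₚ
open import Data.List.Base as List using (List; []; _∷_; length)
open import Data.List.Relation.Unary.All using (All; []; _∷_)
open import Data.Nat.Base as ℕ using (ℕ; zero; suc; NonZero)
import Data.Nat.Properties as ℕₚ
open import Data.Product.Base using (∃-syntax; _×_; _,_; proj₁; proj₂)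
open import Data.Rational.Base as ℚ using (ℚ; 0ℚ; 1ℚ)
import Data.Rational.Properties as ℚₚ
open import Data.Rational.Unnormalised.Base as ℚᵘ using (mkℚᵘ; *≡*)
import Data.Rational.Unnormalised.Properties as ℚᵘₚ
open import Data.Sum.Base using (_⊎_; inj₁; inj₂)
open import Data.Vec.Base using (Vec; []; _∷_; lookup; last; _∷ʳ_)
import Data.Vec.Properties as Vecₚ
import Relation.Binary.Construct.Add.Supremum.NonStrict ℚ._≤_ as ≤⁺
import Relation.Binary.Construct.Add.Supremum.Strict ℚ._<_ as <⁺
open import Relation.Binary.Definitions using (tri<; tri≈; tri>)
open import Relation.Binary.PropositionalEquality as ≡ using (_≡_; refl)
import Relation.Binary.Reasoning.Base.Triple as Triple
import Relation.Binary.Reasoning.Setoid as SetoidReasoning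
open import Relation.Nullary using (¬_; Dec; yes; no; contradiction)

-- Arithmetic of ℚ∞

≤⁺-refl : ∀ {α} → α ≤⁺ α
≤⁺-refl = ≤⁺.≤⁺-reflexive-≡ ℚₚ.≤-reflexive refl

≤⁺-reflexive : ∀ {α β} → α ≡ β → α ≤⁺ β
≤⁺-reflexive refl = ≤⁺-refl

≤⁺-trans : ∀ {α β γ} → α ≤⁺ β → β ≤⁺ γ → α ≤⁺ γ
≤⁺-trans = ≤⁺.≤⁺-trans ℚₚ.≤-trans

<⁺-≤⁺-trans : ∀ {α β γ} → α <⁺ β → β ≤⁺ γ → α <⁺ γ
<⁺-≤⁺-trans = <⁺.<⁺-transˡ ℚₚ.<-≤-trans

≤⁺-<⁺-trans : ∀ {α β γ} → α ≤⁺ β → β <⁺ γ → α <⁺ γ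
≤⁺-<⁺-trans = <⁺.<⁺-transʳ ℚₚ.≤-<-trans

<⁺-irrefl : ∀ {α} → ¬ α <⁺ α
<⁺-irrefl = <⁺.<⁺-irrefl-≡ ℚₚ.<-irrefl refl

<⇒≤⁺ : ∀ {α β} → α <⁺ β → α ≤⁺ β
<⇒≤⁺ [ p ]<  = [ ℚₚ.<⇒≤ p ]≤
<⇒≤⁺ [ k ]<⊤ = [ k ] ≤⊤

≤⁺-antisym : ∀ {α β} → α ≤⁺ β → β ≤⁺ α → α ≡ β
≤⁺-antisym = ≤⁺.≤⁺-antisym-≡ ℚₚ.≤-antisym

module ≤⁺-Reasoning = Triple
  (≤⁺.≤⁺-isPreorder-≡ ℚₚ.≤-isPreorder) (<⁺.<⁺-asym ℚₚ.<-asym) (<⁺.<⁺-trans ℚₚ.<-trans)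
  <⁺.<⁺-resp-≡ <⇒≤⁺ <⁺-≤⁺-trans ≤⁺-<⁺-trans
  using (begin_; begin-strict_; begin-equality_; step-≡-⟩; step-≡-⟨; step-≡-∣; step-≤; step-<; _∎)

≤⁺⊎>⁺ : ∀ α β → α ≤⁺ β ⊎ β <⁺ α
≤⁺⊎>⁺ α β with <⁺.<⁺-cmp-≡ ℚₚ.<-cmp α β
... | tri< α<β _ _    = inj₁ (<⇒≤⁺ α<β)
... | tri≈ _ refl _   = inj₁ ≤⁺-refl
... | tri> _ _ α>β    = inj₂ α>β

finite? : ∀ (α : ℚ∞) → α ≡ ∞ ⊎ (∃[ p ] α ≡ [ p ])
finite? ∞     = inj₁ refl
finite? [ p ] = inj₂ (p , refl)

<⁺-finite : ∀ {α β} → α <⁺ β → ∃[ p ] α ≡ [ p ]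
<⁺-finite [ p ]<   = _ , refl
<⁺-finite [ k ]<⊤ = _ , refl

⊓∞-sel : ∀ α β → α ⊓∞ β ≡ α ⊎ α ⊓∞ β ≡ β
⊓∞-sel [ p ] [ q ] with ℚₚ.⊓-sel p q
... | inj₁ e = inj₁ (≡.cong [_] e)
... | inj₂ e = inj₂ (≡.cong [_] e)
⊓∞-sel [ p ] ∞ = inj₁ refl
⊓∞-sel ∞     β = inj₂ refl

⊓∞-elim : ∀ {ℓ} (P : ℚ∞ → Set ℓ) {α β} → P α → P β → P (α ⊓∞ β)
⊓∞-elim P {α} {β} pα pβ with ⊓∞-sel α β
... | inj₁ e = ≡.subst P (≡.sym e) pα
... | inj₂ e = ≡.subst P (≡.sym e) pβ

⊓∞≤ˡ : ∀ α β → α ⊓∞ β ≤⁺ α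
⊓∞≤ˡ [ p ] [ q ] = [ ℚₚ.p⊓q≤p p q ]≤
⊓∞≤ˡ [ p ] ∞     = ≤⁺-refl
⊓∞≤ˡ ∞     β     = _ ≤⊤

⊓∞≤ʳ : ∀ α β → α ⊓∞ β ≤⁺ β
⊓∞≤ʳ [ p ] [ q ] = [ ℚₚ.p⊓q≤q p q ]≤
⊓∞≤ʳ [ p ] ∞     = _ ≤⊤
⊓∞≤ʳ ∞     β     = ≤⁺-refl

⊓∞-identityʳ : ∀ α → α ⊓∞ ∞ ≡ α
⊓∞-identityʳ [ p ] = refl
⊓∞-identityʳ ∞     = refl

+∞-comm : ∀ α β → α +∞ β ≡ β +∞ α
+∞-comm [ p ] [ q ] = ≡.cong [_] (ℚₚ.+-comm p q)
+∞-comm [ p ] ∞     = refl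
+∞-comm ∞     [ q ] = refl
+∞-comm ∞     ∞     = refl

+∞-assoc : ∀ α β γ → (α +∞ β) +∞ γ ≡ α +∞ (β +∞ γ)
+∞-assoc [ p ] [ q ] [ s ] = ≡.cong [_] (ℚₚ.+-assoc p q s)
+∞-assoc [ p ] [ q ] ∞     = refl
+∞-assoc [ p ] ∞     γ     = refl
+∞-assoc ∞     β     γ     = refl

+∞-identityʳ : ∀ α → α +∞ [ 0ℚ ] ≡ α
+∞-identityʳ [ p ] = ≡.cong [_] (ℚₚ.+-identityʳ p)
+∞-identityʳ ∞     = refl

+∞-identityˡ : ∀ α → [ 0ℚ ] +∞ α ≡ α
+∞-identityˡ α = ≡.trans (+∞-comm [ 0ℚ ] α) (+∞-identityʳ α)

+∞-interchange : ∀ α β γ δ → (α +∞ β) +∞ (γ +∞ δ) ≡ (α +∞ γ) +∞ (β +∞ δ)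
+∞-interchange α β γ δ = begin
  (α +∞ β) +∞ (γ +∞ δ)  ≡⟨ +∞-assoc α β _ ⟩
  α +∞ (β +∞ (γ +∞ δ))  ≡⟨ ≡.cong (α +∞_) (+∞-assoc β γ δ) ⟨
  α +∞ ((β +∞ γ) +∞ δ)  ≡⟨ ≡.cong (λ ρ → α +∞ (ρ +∞ δ)) (+∞-comm β γ) ⟩
  α +∞ ((γ +∞ β) +∞ δ)  ≡⟨ ≡.cong (α +∞_) (+∞-assoc γ β δ) ⟩
  α +∞ (γ +∞ (β +∞ δ))  ≡⟨ +∞-assoc α γ _ ⟨
  (α +∞ γ) +∞ (β +∞ δ)  ∎
  where open ≡.≡-Reasoning

+∞-mono-≤ : ∀ {α β γ δ} → α ≤⁺ β → γ ≤⁺ δ → α +∞ γ ≤⁺ β +∞ δ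
+∞-mono-≤ [ p ]≤ [ q ]≤ = [ ℚₚ.+-mono-≤ p q ]≤
+∞-mono-≤ [ p ]≤ (_ ≤⊤) = _ ≤⊤
+∞-mono-≤ (_ ≤⊤) _      = _ ≤⊤

+∞-mono-≤-< : ∀ {p β γ δ} → [ p ] ≤⁺ β → γ <⁺ δ → [ p ] +∞ γ <⁺ β +∞ δ
+∞-mono-≤-< [ p ]≤ [ q ]<  = [ ℚₚ.+-mono-≤-< p q ]<
+∞-mono-≤-< [ p ]≤ [ k ]<⊤ = [ _ ]<⊤
+∞-mono-≤-< (_ ≤⊤) [ q ]<  = [ _ ]<⊤
+∞-mono-≤-< (_ ≤⊤) [ k ]<⊤ = [ _ ]<⊤

≤⁺-+∞ʳ : ∀ {δ} α → 0ℚ ℚ.≤ δ → α ≤⁺ α +∞ [ δ ]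
≤⁺-+∞ʳ {δ} α 0≤δ = ≡.subst (_≤⁺ α +∞ [ δ ]) (+∞-identityʳ α) (+∞-mono-≤ (≤⁺-refl {α}) [ 0≤δ ]≤)

<⁺-+∞ʳ : ∀ {δ} p → 0ℚ ℚ.< δ → [ p ] <⁺ [ p ] +∞ [ δ ]
<⁺-+∞ʳ {δ} p 0<δ = ≡.subst (_<⁺ [ p ] +∞ [ δ ]) (+∞-identityʳ [ p ]) (+∞-mono-≤-< {p} {[ p ]} ≤⁺-refl [ 0<δ ]<)

+∞-cancelʳ-≤ : ∀ {α β} p → α +∞ [ p ] ≤⁺ β +∞ [ p ] → α ≤⁺ β
+∞-cancelʳ-≤ {α} {β} p le with ≤⁺⊎>⁺ α β
... | inj₁ h = h
... | inj₂ h = contradiction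
  (<⁺-≤⁺-trans (≡.subst₂ _<⁺_ (+∞-comm [ p ] β) (+∞-comm [ p ] α) (+∞-mono-≤-< {p} {[ p ]} ≤⁺-refl h)) le)
  <⁺-irrefl

infixr 8 _·_
-- Iterated addition mirrors iterated multiplication, so the value of `p ^ₚ n` is found by a plain
-- induction; in particular `0 · ∞` is 0, the value of 1.
_·_ : ℕ → ℚ∞ → ℚ∞
zero  · α = [ 0ℚ ]
suc n · α = α +∞ n · α

·-distrib-+∞ : ∀ n α β → n · (α +∞ β) ≡ n · α +∞ n · β
·-distrib-+∞ zero    α β = refl
·-distrib-+∞ (suc n) α β = ≡.trans (≡.cong (α +∞ β +∞_) (·-distrib-+∞ n α β))
                                   (+∞-interchange α β (n · α) (n · β))

·-finite : ∀ n p → ∃[ q ] n · [ p ] ≡ [ q ]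
·-finite zero    p = 0ℚ , refl
·-finite (suc n) p = let q , e = ·-finite n p in p ℚ.+ q , ≡.cong ([ p ] +∞_) e

·-mono-≤ : ∀ n {α β} → α ≤⁺ β → n · α ≤⁺ n · β
·-mono-≤ zero    le = ≤⁺-refl
·-mono-≤ (suc n) le = +∞-mono-≤ le (·-mono-≤ n le)

≤⁺-+∞-·ʳ : ∀ {δ} n α → 0ℚ ℚ.≤ δ → α ≤⁺ α +∞ n · [ δ ]
≤⁺-+∞-·ʳ zero    α 0≤δ = ≤⁺-+∞ʳ α ℚₚ.≤-refl
≤⁺-+∞-·ʳ {δ} (suc n) α 0≤δ = ≤⁺-trans (≤⁺-+∞ʳ α 0≤δ)
  (≡.subst (α +∞ [ δ ] ≤⁺_) (+∞-assoc α [ δ ] (n · [ δ ])) (≤⁺-+∞-·ʳ n (α +∞ [ δ ]) 0≤δ))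

·-∞ : ∀ n .{{_ : NonZero n}} → n · ∞ ≡ ∞
·-∞ (suc n) = refl

suc/1 : ∀ n → + suc n ℚ./ 1 ≡ 1ℚ ℚ.+ (+ n ℚ./ 1)
suc/1 n = ℚₚ.toℚᵘ-injective (begin
  ℚ.toℚᵘ (+ suc n ℚ./ 1)              ≈⟨ ℚₚ.toℚᵘ-fromℚᵘ (mkℚᵘ (+ suc n) 0) ⟩
  mkℚᵘ (+ suc n) 0                     ≈⟨ *≡* (≡.cong (ℤ._* + 1) (≡.sym (≡.cong (ℤ._+_ (+ 1)) (ℤₚ.*-identityʳ (+ n))))) ⟩
  mkℚᵘ (+ 1) 0 ℚᵘ.+ mkℚᵘ (+ n) 0       ≈⟨ ℚᵘₚ.+-congʳ (mkℚᵘ (+ 1) 0) (ℚₚ.toℚᵘ-fromℚᵘ (mkℚᵘ (+ n) 0)) ⟨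
  mkℚᵘ (+ 1) 0 ℚᵘ.+ ℚ.toℚᵘ (+ n ℚ./ 1) ≈⟨ ℚₚ.toℚᵘ-homo-+ 1ℚ (+ n ℚ./ 1) ⟨
  ℚ.toℚᵘ (1ℚ ℚ.+ (+ n ℚ./ 1))          ∎)
  where open ℚᵘₚ.≃-Reasoning

n*1/n : ∀ n .{{_ : NonZero n}} → (+ n ℚ./ 1) ℚ.* (+ 1 ℚ./ n) ≡ 1ℚ
n*1/n n@(suc k) = ℚₚ.toℚᵘ-injective (begin
  ℚ.toℚᵘ ((+ n ℚ./ 1) ℚ.* (+ 1 ℚ./ n))              ≈⟨ ℚₚ.toℚᵘ-homo-* (+ n ℚ./ 1) (+ 1 ℚ./ n) ⟩
  ℚ.toℚᵘ (+ n ℚ./ 1) ℚᵘ.* ℚ.toℚᵘ (+ 1 ℚ./ n)       ≈⟨ ℚᵘₚ.*-cong (ℚₚ.toℚᵘ-fromℚᵘ (mkℚᵘ (+ n) 0)) (ℚₚ.toℚᵘ-fromℚᵘ (mkℚᵘ (+ 1) k)) ⟩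
  mkℚᵘ (+ n) 0 ℚᵘ.* mkℚᵘ (+ 1) k                     ≈⟨ *≡* (≡.trans (ℤₚ.*-identityʳ _) (≡.trans (ℤₚ.*-identityʳ (+ n)) (≡.sym (≡.trans (ℤₚ.*-identityˡ _) (≡.cong (λ m → + suc m) (ℕₚ.+-identityʳ k)))))) ⟩
  ℚ.toℚᵘ 1ℚ                                          ∎)
  where open ℚᵘₚ.≃-Reasoning

·-[] : ∀ n p → n · [ p ] ≡ [ (+ n ℚ./ 1) ℚ.* p ]
·-[] zero    p = ≡.cong [_] (≡.sym (ℚₚ.*-zeroˡ p))
·-[] (suc n) p = begin
  [ p ] +∞ n · [ p ]                      ≡⟨ ≡.cong ([ p ] +∞_) (·-[] n p) ⟩
  [ p ℚ.+ (+ n ℚ./ 1) ℚ.* p ]             ≡⟨ ≡.cong (λ z → [ z ℚ.+ (+ n ℚ./ 1) ℚ.* p ]) (ℚₚ.*-identityˡ p) ⟨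
  [ 1ℚ ℚ.* p ℚ.+ (+ n ℚ./ 1) ℚ.* p ]      ≡⟨ ≡.cong [_] (ℚₚ.*-distribʳ-+ p 1ℚ (+ n ℚ./ 1)) ⟨
  [ (1ℚ ℚ.+ (+ n ℚ./ 1)) ℚ.* p ]          ≡⟨ ≡.cong (λ z → [ z ℚ.* p ]) (suc/1 n) ⟨
  [ (+ suc n ℚ./ 1) ℚ.* p ]               ∎
  where open ≡.≡-Reasoning

module _ (n : ℕ) .{{_ : NonZero n}} where
  private instance
    pos-n : ℚ.Positive (+ n ℚ./ 1)
    pos-n = ℚₚ.normalize-pos n 1
    pos-1/n : ℚ.Positive (+ 1 ℚ./ n)
    pos-1/n = ℚₚ.normalize-pos 1 n

  /∞-mono-< : ∀ {α β} → α <⁺ β → α /∞ n <⁺ β /∞ n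
  /∞-mono-< [ lt ]<  = [ ℚₚ.*-monoˡ-<-pos (+ 1 ℚ./ n) lt ]<
  /∞-mono-< [ k ]<⊤ = [ _ ]<⊤

  ·-cancel-≤ : ∀ {α β} → n · α ≤⁺ n · β → α ≤⁺ β
  ·-cancel-≤ {α}     {∞}     _  = α ≤⊤
  ·-cancel-≤ {∞}     {[ q ]} le with ≡.subst₂ _≤⁺_ (·-∞ n) (·-[] n q) le
  ... | ()
  ·-cancel-≤ {[ p ]} {[ q ]} le with ≡.subst₂ _≤⁺_ (·-[] n p) (·-[] n q) le
  ... | [ le′ ]≤ = [ ℚₚ.*-cancelˡ-≤-pos (+ n ℚ./ 1) le′ ]≤

  ·-/∞ : ∀ α → n · (α /∞ n) ≡ α
  ·-/∞ ∞     = ·-∞ n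
  ·-/∞ [ p ] = ≡.trans (·-[] n _) (≡.cong [_] (begin
    (+ n ℚ./ 1) ℚ.* (p ℚ.* (+ 1 ℚ./ n)) ≡⟨ ≡.cong ((+ n ℚ./ 1) ℚ.*_) (ℚₚ.*-comm p _) ⟩
    (+ n ℚ./ 1) ℚ.* ((+ 1 ℚ./ n) ℚ.* p) ≡⟨ ℚₚ.*-assoc (+ n ℚ./ 1) (+ 1 ℚ./ n) p ⟨
    ((+ n ℚ./ 1) ℚ.* (+ 1 ℚ./ n)) ℚ.* p ≡⟨ ≡.cong (ℚ._* p) (n*1/n n) ⟩
    1ℚ ℚ.* p                            ≡⟨ ℚₚ.*-identityˡ p ⟩
    p                                   ∎))
    where open ≡.≡-Reasoning

·-zeroʳ : ∀ n → n · [ 0ℚ ] ≡ [ 0ℚ ]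
·-zeroʳ zero    = refl
·-zeroʳ (suc n) = ≡.cong ([ 0ℚ ] +∞_) (·-zeroʳ n)

·-comm : ∀ m n α → m · n · α ≡ n · m · α
·-comm zero    n α = ≡.sym (·-zeroʳ n)
·-comm (suc m) n α = ≡.trans (≡.cong (n · α +∞_) (·-comm m n α)) (≡.sym (·-distrib-+∞ n α (m · α)))

module _ (m n : ℕ) .{{_ : NonZero m}} .{{_ : NonZero n}} {α β : ℚ∞} where
  private
    scaled : ∀ (γ : ℚ∞) (k : ℕ) .{{_ : NonZero k}} l → l · γ ≡ k · l · (γ /∞ k)
    scaled γ k l = ≡.trans (≡.cong (l ·_) (≡.sym (·-/∞ k γ))) (·-comm l k (γ /∞ k))

  -- Slopes are compared after clearing denominators, because the estimates below concern powers of
  -- equal degree such as f ^ deg F and F ^ deg f.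
  cross⇒/∞-≤ : n · α ≤⁺ m · β → α /∞ m ≤⁺ β /∞ n
  cross⇒/∞-≤ le = ·-cancel-≤ n (·-cancel-≤ m
    (≡.subst₂ _≤⁺_ (scaled α m n) (≡.cong (m ·_) (≡.sym (·-/∞ n β))) le))

  /∞-≤⇒cross : α /∞ m ≤⁺ β /∞ n → n · α ≤⁺ m · β
  /∞-≤⇒cross le = ≡.subst₂ _≤⁺_ (≡.sym (scaled α m n)) (≡.cong (m ·_) (·-/∞ n β))
    (·-mono-≤ m (·-mono-≤ n le))

-- Polynomials over a field

module PolyDegree {c ℓ} (K : Field c ℓ) where
  open Field K hiding (zero) renaming (refl to ≈-refl; sym to ≈-sym; trans to ≈-trans)
  open Polynomial K hiding (Poly; MonicPoly)
  open RingProperties ring using (-0#≈0#)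

  open SetoidReasoning setoid

  0+0≈0 : 0# + 0# ≈ 0#
  0+0≈0 = +-identityˡ 0#

  coeff-+ : ∀ p q n → coeff (p +ₚ q) n ≈ coeff p n + coeff q n
  coeff-+ []      q       n       = ≈-sym (+-identityˡ _)
  coeff-+ (a ∷ p) []      n       = ≈-sym (+-identityʳ _)
  coeff-+ (a ∷ p) (b ∷ q) zero    = ≈-refl
  coeff-+ (a ∷ p) (b ∷ q) (suc n) = coeff-+ p q n

  coeff-neg : ∀ p n → coeff (-ₚ p) n ≈ - coeff p n
  coeff-neg []      n       = ≈-sym -0#≈0#
  coeff-neg (a ∷ p) zero    = ≈-refl
  coeff-neg (a ∷ p) (suc n) = coeff-neg p n

  coeff-scale : ∀ a p n → coeff (scale a p) n ≈ a * coeff p n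
  coeff-scale a []      n       = ≈-sym (zeroʳ a)
  coeff-scale a (b ∷ p) zero    = ≈-refl
  coeff-scale a (b ∷ p) (suc n) = coeff-scale a p n

  below-length : ∀ p → DegreeBelow (length p) p
  below-length []      n       _           = ≈-refl
  below-length (a ∷ p) (suc n) (ℕ.s≤s len≤n) = below-length p n len≤n

  below-mono : ∀ {m n} p → m ℕ.≤ n → DegreeBelow m p → DegreeBelow n p
  below-mono p m≤n below i n≤i = below i (ℕₚ.≤-trans m≤n n≤i)

  below-cong : ∀ {m} p q → p ≈ₚ q → DegreeBelow m p → DegreeBelow m q
  below-cong p q p≈q below i m≤i = ≈-trans (≈-sym (p≈q i)) (below i m≤i)

  below-+ : ∀ {m} p q → DegreeBelow m p → DegreeBelow m q → DegreeBelow m (p +ₚ q)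
  below-+ p q bp bq i m≤i =
    ≈-trans (coeff-+ p q i) (≈-trans (+-cong (bp i m≤i) (bq i m≤i)) 0+0≈0)

  below-suc : ∀ {m} p → DegreeBelow (suc m) p → coeff p m ≈ 0# → DegreeBelow m p
  below-suc {m} p below top≈0 i m≤i with ℕₚ.m≤n⇒m<n∨m≡n m≤i
  ... | inj₁ m<i  = below i m<i
  ... | inj₂ refl = top≈0

  *ₚ-vanishˡ : ∀ p q → DegreeBelow 0 p → DegreeBelow 0 (p *ₚ q)
  *ₚ-vanishˡ []      q p≈0 i _ = ≈-refl
  *ₚ-vanishˡ (a ∷ p) q p≈0 i _ = begin
    coeff (scale a q +ₚ (0# ∷ p *ₚ q)) i           ≈⟨ coeff-+ (scale a q) _ i ⟩
    coeff (scale a q) i + coeff (0# ∷ p *ₚ q) i    ≈⟨ +-cong (coeff-scale a q i) (rest i) ⟩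
    a * coeff q i + 0#                             ≈⟨ +-identityʳ _ ⟩
    a * coeff q i                                  ≈⟨ *-congʳ (p≈0 0 ℕ.z≤n) ⟩
    0# * coeff q i                                 ≈⟨ zeroˡ _ ⟩
    0#                                             ∎
    where
    rest : ∀ i → coeff (0# ∷ p *ₚ q) i ≈ 0#
    rest zero    = ≈-refl
    rest (suc i) = *ₚ-vanishˡ p q (λ j _ → p≈0 (suc j) ℕ.z≤n) i ℕ.z≤n

  *ₚ-vanishʳ : ∀ p q → DegreeBelow 0 q → DegreeBelow 0 (p *ₚ q)
  *ₚ-vanishʳ []      q q≈0 i _ = ≈-refl
  *ₚ-vanishʳ (a ∷ p) q q≈0 i _ = begin
    coeff (scale a q +ₚ (0# ∷ p *ₚ q)) i           ≈⟨ coeff-+ (scale a q) _ i ⟩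
    coeff (scale a q) i + coeff (0# ∷ p *ₚ q) i    ≈⟨ +-cong (coeff-scale a q i) (rest i) ⟩
    a * coeff q i + 0#                             ≈⟨ +-identityʳ _ ⟩
    a * coeff q i                                  ≈⟨ *-congˡ (q≈0 i ℕ.z≤n) ⟩
    a * 0#                                         ≈⟨ zeroʳ _ ⟩
    0#                                             ∎
    where
    rest : ∀ i → coeff (0# ∷ p *ₚ q) i ≈ 0#
    rest zero    = ≈-refl
    rest (suc i) = *ₚ-vanishʳ p q q≈0 i ℕ.z≤n

  -- The bounds mean deg p < m and deg q ≤ n. With this asymmetry no degree has to be subtracted,
  -- and m = 0 covers p = 0.
  below-* : ∀ {m n} p q → DegreeBelow m p → DegreeBelow (suc n) q → DegreeBelow (m ℕ.+ n) (p *ₚ q)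
  below-* {zero}      p       q bp bq i       _           = *ₚ-vanishˡ p q bp i ℕ.z≤n
  below-* {suc m}     []      q bp bq i       _           = ≈-refl
  below-* {suc m} {n} (a ∷ p) q bp bq (suc i) (ℕ.s≤s le) = begin
    coeff (scale a q +ₚ (0# ∷ p *ₚ q)) (suc i)      ≈⟨ coeff-+ (scale a q) _ (suc i) ⟩
    coeff (scale a q) (suc i) + coeff (p *ₚ q) i    ≈⟨ +-cong (coeff-scale a q (suc i)) (below-* p q bp′ bq i le) ⟩
    a * coeff q (suc i) + 0#                        ≈⟨ +-identityʳ _ ⟩
    a * coeff q (suc i)                             ≈⟨ *-congˡ (bq (suc i) (ℕ.s≤s (ℕₚ.≤-trans (ℕₚ.m≤n+m n m) le))) ⟩
    a * 0#                                          ≈⟨ zeroʳ _ ⟩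
    0#                                              ∎
    where
    bp′ : DegreeBelow m p
    bp′ j m≤j = bp (suc j) (ℕ.s≤s m≤j)

  -- The coefficient a may be zero, so n is only an upper bound for the degree. This lets `divide`
  -- cancel a top coefficient without testing it.
  record Leading (p : Poly K) (n : ℕ) (a : Carrier) : Set ℓ where
    constructor _,_
    field
      top   : coeff p n ≈ a
      below : DegreeBelow (suc n) p

  open Leading public

  leading-cong : ∀ {p q n a b} → p ≈ₚ q → a ≈ b → Leading p n a → Leading q n b
  leading-cong {p} {q} p≈q a≈b (t , b) = ≈-trans (≈-sym (p≈q _)) (≈-trans t a≈b) , below-cong p q p≈q b

  leading-monic : (f : MonicPoly K) → Leading (poly f) (degree f) 1#
  leading-monic f = coeff-degree f , coeff-above f

  leading-const : ∀ a → Leading (a ∷ []) 0 a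
  leading-const a = ≈-refl , λ { (suc i) _ → ≈-refl }

  top-* : ∀ {m n a b} p q → Leading p m a → Leading q n b → coeff (p *ₚ q) (m ℕ.+ n) ≈ a * b
  top-* {zero} {n} {a} {b} [] q (t , _) _ = ≈-sym (≈-trans (*-congʳ (≈-sym t)) (zeroˡ b))
  top-* {suc m} {n} {a} {b} [] q (t , _) _ = ≈-sym (≈-trans (*-congʳ (≈-sym t)) (zeroˡ b))
  top-* {zero} {n} {a} {b} (c ∷ p) q (t , bp) (u , _) = begin
    coeff (scale c q +ₚ (0# ∷ p *ₚ q)) n           ≈⟨ coeff-+ (scale c q) _ n ⟩
    coeff (scale c q) n + coeff (0# ∷ p *ₚ q) n    ≈⟨ +-cong (≈-trans (coeff-scale c q n) (*-cong t u)) (rest n) ⟩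
    a * b + 0#                                     ≈⟨ +-identityʳ _ ⟩
    a * b                                          ∎
    where
    rest : ∀ i → coeff (0# ∷ p *ₚ q) i ≈ 0#
    rest zero    = ≈-refl
    rest (suc i) = *ₚ-vanishˡ p q (λ j _ → bp (suc j) (ℕ.s≤s ℕ.z≤n)) i ℕ.z≤n
  top-* {suc m} {n} {a} {b} (c ∷ p) q (t , bp) lq@(u , bq) = begin
    coeff (scale c q +ₚ (0# ∷ p *ₚ q)) (suc (m ℕ.+ n))              ≈⟨ coeff-+ (scale c q) _ (suc (m ℕ.+ n)) ⟩
    coeff (scale c q) (suc (m ℕ.+ n)) + coeff (p *ₚ q) (m ℕ.+ n)
      ≈⟨ +-cong (coeff-scale c q (suc (m ℕ.+ n))) (top-* p q (t , λ j le → bp (suc j) (ℕ.s≤s le)) lq) ⟩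
    c * coeff q (suc (m ℕ.+ n)) + a * b
      ≈⟨ +-congʳ (≈-trans (*-congˡ (bq (suc (m ℕ.+ n)) (ℕ.s≤s (ℕₚ.m≤n+m n m)))) (zeroʳ c)) ⟩
    0# + a * b                                                       ≈⟨ +-identityˡ _ ⟩
    a * b                                                            ∎

  leading-* : ∀ {m n a b} p q → Leading p m a → Leading q n b → Leading (p *ₚ q) (m ℕ.+ n) (a * b)
  leading-* p q lp lq = top-* p q lp lq , below-* p q (below lp) (below lq)

  leading-^ : ∀ {d} p → Leading p d 1# → ∀ n → Leading (p ^ₚ n) (n ℕ.* d) 1#
  leading-^ p lp zero    = leading-const 1#
  leading-^ p lp (suc n) = leading-cong (λ _ → ≈-refl) (*-identityˡ 1#)
    (leading-* p (p ^ₚ n) lp (leading-^ p lp n))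

  below-difference : ∀ {n a} p q → Leading p n a → Leading q n a → DegreeBelow n (p +ₚ -ₚ q)
  below-difference {n} {a} p q (t , bp) (u , bq) = below-suc (p +ₚ -ₚ q) bd (begin
    coeff (p +ₚ -ₚ q) n              ≈⟨ coeff-+ p (-ₚ q) n ⟩
    coeff p n + coeff (-ₚ q) n       ≈⟨ +-cong t (≈-trans (coeff-neg q n) (-‿cong u)) ⟩
    a - a                            ≈⟨ -‿inverseʳ a ⟩
    0#                               ∎)
    where
    bd : DegreeBelow (suc n) (p +ₚ -ₚ q)
    bd = below-+ p (-ₚ q) bp (λ i le → ≈-trans (coeff-neg q i) (≈-trans (-‿cong (bq i le)) -0#≈0#))

  monomial : ℕ → Carrier → Poly K
  monomial zero    a = a ∷ []
  monomial (suc n) a = 0# ∷ monomial n a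

  leading-monomial : ∀ n a → Leading (monomial n a) n a
  leading-monomial zero    a = leading-const a
  leading-monomial (suc n) a = top (leading-monomial n a) ,
    λ { (suc i) (ℕ.s≤s le) → below (leading-monomial n a) i le }

  module _ (≈0? : ∀ a → Dec (a ≈ 0#)) where

    -- Lists may end in zeros, so the degree has to be found by testing coefficients, beginning with
    -- the highest.
    vanishes⊎leading : ∀ p → DegreeBelow 0 p ⊎ (∃[ n ] ∃[ a ] a ≉ 0# × Leading p n a)
    vanishes⊎leading [] = inj₁ (λ _ _ → ≈-refl)
    vanishes⊎leading (a ∷ p) with vanishes⊎leading p | ≈0? a
    ... | inj₂ (n , b , b≉0 , (t , bp)) | _ =
          inj₂ (suc n , b , b≉0 , (t , λ { (suc i) (ℕ.s≤s le) → bp i le }))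
    ... | inj₁ p≈0 | yes a≈0 = inj₁ λ { zero _ → a≈0 ; (suc i) _ → p≈0 i ℕ.z≤n }
    ... | inj₁ p≈0 | no  a≉0 = inj₂ (0 , a , a≉0 , (≈-refl , λ { (suc i) _ → p≈0 i ℕ.z≤n }))

-- Evaluation of polynomials

module _ {c ℓ} {K L : Field c ℓ} (ι : FieldHom K L) where
  private
    module K = Field K
    module L = Field L
    module Kₚ = Polynomial K
    module ι = FieldHom ι
    open RingProperties L.ring using (-‿+-comm; -0#≈0#; -‿distribʳ-*)

  eval-vanish : ∀ p y → Kₚ.DegreeBelow 0 p → eval ι p y L.≈ L.0#
  eval-vanish []      y p≈0 = L.refl
  eval-vanish (a ∷ p) y p≈0 = L.trans (L.+-cong (L.trans (ι.⟦⟧-cong (p≈0 0 ℕ.z≤n)) ι.0#-homo)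
    (L.trans (L.*-congˡ (eval-vanish p y (λ i _ → p≈0 (suc i) ℕ.z≤n))) (L.zeroʳ y))) (L.+-identityˡ _)

  eval-cong : ∀ p q y → p Kₚ.≈ₚ q → eval ι p y L.≈ eval ι q y
  eval-cong []      q       y p≈q = L.sym (eval-vanish q y (λ i _ → K.sym (p≈q i)))
  eval-cong (a ∷ p) []      y p≈q = eval-vanish (a ∷ p) y (λ i _ → p≈q i)
  eval-cong (a ∷ p) (b ∷ q) y p≈q =
    L.+-cong (ι.⟦⟧-cong (p≈q 0)) (L.*-congˡ (eval-cong p q y (λ i → p≈q (suc i))))

  eval-neg : ∀ p y → eval ι (Kₚ.-ₚ p) y L.≈ L.- eval ι p y
  eval-neg []      y = L.sym -0#≈0#
  eval-neg (a ∷ p) y = L.trans (L.+-cong (ι.-‿homo a)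
    (L.trans (L.*-congˡ (eval-neg p y)) (L.sym (-‿distribʳ-* y _)))) (-‿+-comm _ _)

module _ {c ℓ} {K L M : Field c ℓ} (ι : FieldHom K L) (κ : FieldHom L M) where

  compose : FieldHom K M
  compose = record { isRingHomomorphism = Composition.isRingHomomorphism (Field.trans M)
    (FieldHom.isRingHomomorphism ι) (FieldHom.isRingHomomorphism κ) }

  eval-compose : ∀ p y → eval κ (mapPoly ι p) y ≡ eval compose p y
  eval-compose []      y = refl
  eval-compose (a ∷ p) y = ≡.cong (λ z → Field._+_ M _ (Field._*_ M y z)) (eval-compose p y)

-- Elementary properties of valuations

module ValuationProperties {c ℓ} {K : Field c ℓ} (v : Valuation K) where
  open Field K hiding (zero) renaming (refl to ≈-refl; sym to ≈-sym; trans to ≈-trans)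
  open Valuation v
  open RingProperties ring using (-1*x≈-x; -‿involutive)

  ≈0? : ∀ a → Dec (a ≈ 0#)
  ≈0? a with finite? (val a)
  ... | inj₁ e       = yes (val-∞ e)
  ... | inj₂ (p , e) = no λ a≈0 → contradiction
        (≡.trans (≡.sym e) (≡.trans (val-cong a≈0) val-0)) λ ()

  -- The square of -1 is 1, so twice the value of -1 is 0, and ℚ has no torsion.
  val-neg : ∀ a → val (- a) ≡ val a
  val-neg a = ≡.trans (val-cong (≈-sym (-1*x≈-x a)))
    (≡.trans (val-* (- 1#) a) (≡.trans (≡.cong (_+∞ val a) val-‿1) (+∞-identityˡ (val a))))
    where
    twice : val (- 1#) +∞ val (- 1#) ≡ [ 0ℚ ]
    twice = ≡.trans (≡.sym (val-* (- 1#) (- 1#)))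
      (≡.trans (val-cong (≈-trans (-1*x≈-x (- 1#)) (-‿involutive 1#))) val-1)
    val-‿1 : val (- 1#) ≡ [ 0ℚ ]
    val-‿1 = ≤⁺-antisym (·-cancel-≤ 2 (≤⁺-reflexive doubled)) (·-cancel-≤ 2 (≤⁺-reflexive (≡.sym doubled)))
      where
      doubled : 2 · val (- 1#) ≡ 2 · [ 0ℚ ]
      doubled = ≡.trans (≡.cong (val (- 1#) +∞_) (+∞-identityʳ _)) twice

-- The commutative ring K[x]

module PolynomialRing {c ℓ} (K E : Field c ℓ) (ι : FieldHom K E) (x : Field.Carrier E)
                      (isRational : IsRationalFunctionField ι x) where
  open Polynomial K hiding (Poly; MonicPoly)
  open IsRationalFunctionField isRational
  private
    module K where
      open Field K public
      open PolyDegree K public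
    module E where
      open Field E public
      open RingProperties (Field.ring E) public using (x≈y⇒x∙y⁻¹≈ε)
  open RingProperties K.ring using (x∙y⁻¹≈ε⇒x≈y)

  infix 4 _≋_

  -- _≈ₚ_ as a record, so that unification can read off p and q.
  record _≋_ (p q : Poly K) : Set ℓ where
    constructor coeffwise
    field
      at : p ≈ₚ q

  open _≋_ public

  -- As x is transcendental, K[x] inherits the ring laws from K(x).
  evalₓ-isRingMonomorphism : RingMorphisms.IsRingMonomorphism (record polyRawRing { _≈_ = _≋_ }) E.rawRing (λ p → eval ι p x)
  evalₓ-isRingMonomorphism = record
    { isRingHomomorphism = record
      { isSemiringHomomorphism = record
        { isNearSemiringHomomorphism = record
          { +-isMonoidHomomorphism = record
            { isMagmaHomomorphism = record
              { isRelHomomorphism = record { cong = λ {p} {q} p≋q → eval-cong ι p q x (at p≋q) }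
              ; homo = λ p q → eval-+ ι p q x
              }
            ; ε-homo = E.refl
            }
          ; *-homo = λ p q → eval-* ι p q x
          }
        ; 1#-homo = eval-1 ι x
        }
      ; -‿homo = λ p → eval-neg ι p x
      }
    ; injective = λ {p} {q} e → coeffwise λ n → x∙y⁻¹≈ε⇒x≈y (coeff p n) (coeff q n)
        (K.trans (K.sym (K.trans (K.coeff-+ p (-ₚ q) n) (K.+-congˡ (K.coeff-neg q n))))
          (transcendental (p +ₚ -ₚ q)
            (E.trans (eval-+ ι p (-ₚ q) x)
              (E.trans (E.+-congˡ (eval-neg ι q x)) (E.x≈y⇒x∙y⁻¹≈ε e))) n))
    }

  polyRing : CommutativeRing c ℓ
  polyRing = record
    { isCommutativeRing = RingMonomorphism.isCommutativeRing evalₓ-isRingMonomorphism E.isCommutativeRing }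

-- Entries of vectors

module _ {a} {A : Set a} where

  lookup-∷ʳ-inject₁ : ∀ {n} (xs : Vec A n) x i → lookup (xs ∷ʳ x) (inject₁ i) ≡ lookup xs i
  lookup-∷ʳ-inject₁ (y ∷ xs) x zero    = refl
  lookup-∷ʳ-inject₁ (y ∷ xs) x (suc i) = lookup-∷ʳ-inject₁ xs x i

  lookup-∷ʳ-fromℕ : ∀ {n} (xs : Vec A n) x → lookup (xs ∷ʳ x) (fromℕ n) ≡ x
  lookup-∷ʳ-fromℕ []       x = refl
  lookup-∷ʳ-fromℕ (y ∷ xs) x = lookup-∷ʳ-fromℕ xs x

  increasing⇒≤last : ∀ (f : A → ℕ) {n} (xs : Vec A (suc n)) →
                     (∀ i j → i Fin.< j → f (lookup xs i) ℕ.< f (lookup xs j)) →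
                     ∀ i → f (lookup xs i) ℕ.≤ f (last xs)
  increasing⇒≤last f (x ∷ [])         inc zero    = ℕₚ.≤-refl
  increasing⇒≤last f (x ∷ xs@(y ∷ _)) inc zero    = ℕₚ.≤-trans (ℕₚ.<⇒≤ (inc zero (suc zero) (ℕ.s≤s ℕ.z≤n)))
    (increasing⇒≤last f xs (λ i j i<j → inc (suc i) (suc j) (ℕ.s≤s i<j)) zero)
  increasing⇒≤last f (x ∷ xs@(y ∷ _)) inc (suc i) =
    increasing⇒≤last f xs (λ i j i<j → inc (suc i) (suc j) (ℕ.s≤s i<j)) i

module _ {c ℓ} (S : Setting c ℓ) where
  open Theory S
  open Polynomial K hiding (Poly; MonicPoly)
  open PolyDegree K
  open PolynomialRing K K⟨x⟩ ιₓ x isRationalFunctionField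
  open Valuation using (val)
  private
    module K = Field K
    module P where
      open CommutativeRing polyRing public
      open RingProperties (CommutativeRing.ring polyRing) public
      open SetoidReasoning (CommutativeRing.setoid polyRing) public
    module K̂ where
      open Field K̂ public
      open SetoidReasoning (Field.setoid K̂) public
    module K̂ₚ where
      open Polynomial K̂ public
      open PolyDegree K̂ public
    module K̄ where
      open Field K̄ public
      open RingProperties (Field.ring K̄) public
      open SetoidReasoning (Field.setoid K̄) public

  -- Long division: subtracting s g, where s is a monomial of exponent m, cancels the coefficient of
  -- f at m + k. The bound on the quotient is what drives the later inductions on the number of
  -- digits of an expansion.
  divide : ∀ g k → Leading g k K.1# → ∀ m f → DegreeBelow (m ℕ.+ k) f →
           ∃[ q ] ∃[ t ] (f ≋ q *ₚ g +ₚ t) × DegreeBelow k t × DegreeBelow m q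
  divide g k lg zero    f bf = [] , f , P.refl , bf , (λ _ _ → K.refl)
  divide g k lg (suc m) f bf with divide g k lg m (f +ₚ -ₚ (s *ₚ g)) (below-difference f (s *ₚ g) (K.refl , bf) ls)
    where
    s = monomial m (coeff f (m ℕ.+ k))
    ls : Leading (s *ₚ g) (m ℕ.+ k) (coeff f (m ℕ.+ k))
    ls = leading-cong (λ _ → K.refl) (K.*-identityʳ _) (leading-* s g (leading-monomial m _) lg)
  ... | q , t , e , bt , bq = q +ₚ s , t , identity , bt ,
        below-+ q s (below-mono q (ℕₚ.n≤1+n m) bq) (below (leading-monomial m _))
    where
    s = monomial m (coeff f (m ℕ.+ k))
    identity : f ≋ (q +ₚ s) *ₚ g +ₚ t
    identity = P.begin
      f                                       P.≈⟨ P.//-rightDividesˡ (s *ₚ g) f ⟨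
      f +ₚ -ₚ (s *ₚ g) +ₚ s *ₚ g              P.≈⟨ P.+-congʳ e ⟩
      q *ₚ g +ₚ t +ₚ s *ₚ g                   P.≈⟨ P.+-assoc (q *ₚ g) t (s *ₚ g) ⟩
      q *ₚ g +ₚ (t +ₚ s *ₚ g)                 P.≈⟨ P.+-congˡ {q *ₚ g} (P.+-comm t (s *ₚ g)) ⟩
      q *ₚ g +ₚ (s *ₚ g +ₚ t)                 P.≈⟨ P.+-assoc (q *ₚ g) (s *ₚ g) t ⟨
      q *ₚ g +ₚ s *ₚ g +ₚ t                   P.≈⟨ P.+-congʳ (P.distribʳ g q s) ⟨
      (q +ₚ s) *ₚ g +ₚ t                      P.∎

  -- Pseudo-valuations of K[x]

  constant-≋ : ∀ a → DegreeBelow 1 a → a ≋ coeff a 0 ∷ []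
  constant-≋ a ba = coeffwise λ { zero → K.refl ; (suc i) → ba (suc i) (ℕ.s≤s ℕ.z≤n) }

  -- A non-zero polynomial may have the value ∞, as F does under g ↦ v(g(θ)). This map and the
  -- valuations μᵢ are thus treated alike.
  record PseudoValuation : Set (c ⊔ ℓ) where
    field
      w       : Poly K → ℚ∞
      w-cong  : ∀ {p q} → p ≋ q → w p ≡ w q
      w-*     : ∀ p q → w (p *ₚ q) ≡ w p +∞ w q
      w-+     : ∀ p q → w p ⊓∞ w q ≤⁺ w (p +ₚ q)
      w-const : ∀ a → w (a ∷ []) ≡ val v a

    w-0 : w 0ₚ ≡ ∞
    w-0 = ≡.trans (w-cong (coeffwise λ { zero → K.refl ; (suc _) → K.refl }))
            (≡.trans (w-const K.0#) (Valuation.val-0 v))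

    w-1 : w 1ₚ ≡ [ 0ℚ ]
    w-1 = ≡.trans (w-const K.1#) (Valuation.val-1 v)

    w-neg : ∀ p → w (-ₚ p) ≡ w p
    w-neg p = ≡.trans (w-cong (P.sym (P.-1*x≈-x p))) (≡.trans (w-* (-ₚ 1ₚ) p)
      (≡.trans (≡.cong (_+∞ w p) (≡.trans (w-const (K.- K.1#)) (≡.trans
        (ValuationProperties.val-neg v K.1#) (Valuation.val-1 v)))) (+∞-identityˡ (w p))))

    w-^ : ∀ p n → w (p ^ₚ n) ≡ n · w p
    w-^ p zero    = w-1
    w-^ p (suc n) = ≡.trans (w-* p (p ^ₚ n)) (≡.cong (w p +∞_) (w-^ p n))

    ≤-w-+ : ∀ {γ} p q → γ ≤⁺ w p → γ ≤⁺ w q → γ ≤⁺ w (p +ₚ q)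
    ≤-w-+ {γ} p q γ≤p γ≤q = ≤⁺-trans (⊓∞-elim (γ ≤⁺_) γ≤p γ≤q) (w-+ p q)

    <-w-+ : ∀ {γ} p q → γ <⁺ w p → γ <⁺ w q → γ <⁺ w (p +ₚ q)
    <-w-+ {γ} p q γ<p γ<q = <⁺-≤⁺-trans (⊓∞-elim (γ <⁺_) γ<p γ<q) (w-+ p q)

    ≤-w-cancelʳ : ∀ {γ} p q → γ ≤⁺ w (p +ₚ q) → γ ≤⁺ w q → γ ≤⁺ w p
    ≤-w-cancelʳ {γ} p q γ≤p+q γ≤q =
      ≡.subst (γ ≤⁺_) (w-cong (P.//-rightDividesʳ q p))
        (≤-w-+ (p +ₚ q) (-ₚ q) γ≤p+q (≡.subst (γ ≤⁺_) (≡.sym (w-neg q)) γ≤q))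

    <-w-cancelˡ : ∀ {γ} p q → γ <⁺ w (p +ₚ q) → γ <⁺ w p → γ <⁺ w q
    <-w-cancelˡ {γ} p q γ<p+q γ<p =
      ≡.subst (γ <⁺_) (w-cong (P.xyx⁻¹≈y p q))
        (<-w-+ (p +ₚ q) (-ₚ p) γ<p+q (≡.subst (γ <⁺_) (≡.sym (w-neg p)) γ<p))

    -- The value of a sum can exceed that of p only if q cancels the dominant part of p.
    w-absorb : ∀ p q → w p <⁺ w (p +ₚ q) → w q ≡ w p
    w-absorb p q lt with ≤⁺⊎>⁺ (w q) (w p)
    ... | inj₂ p<q = contradiction
          (<-w-cancelˡ q p (≡.subst (w p <⁺_) (w-cong (P.+-comm p q)) lt) p<q) <⁺-irrefl
    ... | inj₁ q≤p = ≤⁺-antisym q≤p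
          (≤-w-cancelʳ q p (≡.subst (w p ≤⁺_) (w-cong (P.+-comm p q)) (<⇒≤⁺ lt)) ≤⁺-refl)

  open PseudoValuation

  module _ {L : Field c ℓ} (ι : FieldHom K L) (V : Valuation L) (extends : Extends ι V v)
           (y : Field.Carrier L) where
    open Valuation V using (val-cong; val-*; val-+)
    private module L = Field L

    evaluation : PseudoValuation
    evaluation = record
      { w       = λ p → val V (eval ι p y)
      ; w-cong  = λ {p} {q} p≋q → val-cong (eval-cong ι p q y (at p≋q))
      ; w-*     = λ p q → ≡.trans (val-cong (eval-* ι p q y)) (val-* _ _)
      ; w-+     = λ p q → ≡.subst (val V _ ⊓∞ val V _ ≤⁺_) (≡.sym (val-cong (eval-+ ι p q y))) (val-+ _ _)
      ; w-const = λ a → ≡.trans (val-cong (L.trans (L.+-congˡ (L.zeroʳ y)) (L.+-identityʳ _))) (extends a)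
      }

  restriction : 𝕍 → PseudoValuation
  restriction μ = evaluation ιₓ (valuation μ) (restricts μ) x

  -- Expansions with respect to a monic polynomial

  slope : PseudoValuation → MonicPoly K → ℚ∞
  slope μ f = w μ (poly f) /deg f

  -- Applied repeatedly, together with `expands-quotient`, this says that μ(g) is the minimum of the
  -- values of the terms in the φ-expansion of g. One division at a time is easier to iterate.
  Expands : PseudoValuation → MonicPoly K → Set (c ⊔ ℓ)
  Expands μ φ = ∀ q a → DegreeBelow (degree φ) a → w μ (q *ₚ poly φ +ₚ a) ≤⁺ w μ a

  -- The product q φ is the dividend minus the remainder, and neither of these has a smaller value
  -- than the dividend.
  expands-quotient : ∀ μ φ → Expands μ φ → ∀ q a → DegreeBelow (degree φ) a →
                     w μ (q *ₚ poly φ +ₚ a) ≤⁺ w μ q +∞ w μ (poly φ)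
  expands-quotient μ φ ex q a ba = ≡.subst (w μ (q *ₚ poly φ +ₚ a) ≤⁺_) (w-* μ q (poly φ))
    (≤-w-cancelʳ μ (q *ₚ poly φ) a ≤⁺-refl (ex q a ba))

  -- The sum is a general monic polynomial of degree k deg F. The leading digit of its F-expansion
  -- is 1, so F ^ k is one of the terms whose values bound μ from above.
  expands-power : ∀ μ F → Expands μ F → ∀ k R → DegreeBelow (k ℕ.* degree F) R →
                  w μ (poly F ^ₚ k +ₚ R) ≤⁺ k · w μ (poly F)
  expands-power μ F ex zero    R bR = ≤⁺-reflexive (≡.trans
    (w-cong μ (P.trans (P.+-congˡ {1ₚ} {R} {0ₚ} (coeffwise λ n → bR n ℕ.z≤n)) (P.+-identityʳ 1ₚ))) (w-1 μ))
  expands-power μ F ex (suc k) R bR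
    with divide (poly F) (degree F) (leading-monic F) (k ℕ.* degree F) R
           (≡.subst (λ m → DegreeBelow m R) (ℕₚ.+-comm (degree F) _) bR)
  ... | q , a , e , ba , bq = begin
        w μ (G ^ₚ suc k +ₚ R)             ≡⟨ w-cong μ regroup ⟩
        w μ ((G ^ₚ k +ₚ q) *ₚ G +ₚ a)     ≤⟨ expands-quotient μ F ex (G ^ₚ k +ₚ q) a ba ⟩
        w μ (G ^ₚ k +ₚ q) +∞ w μ G        ≤⟨ +∞-mono-≤ (expands-power μ F ex k q bq) ≤⁺-refl ⟩
        k · w μ G +∞ w μ G                ≡⟨ +∞-comm (k · w μ G) (w μ G) ⟩
        w μ G +∞ k · w μ G                ∎
    where
    open ≤⁺-Reasoning
    G = poly F
    regroup : G ^ₚ suc k +ₚ R ≋ (G ^ₚ k +ₚ q) *ₚ G +ₚ a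
    regroup = P.begin
      G *ₚ G ^ₚ k +ₚ R                  P.≈⟨ P.+-cong (P.*-comm G (G ^ₚ k)) e ⟩
      G ^ₚ k *ₚ G +ₚ (q *ₚ G +ₚ a)      P.≈⟨ P.+-assoc (G ^ₚ k *ₚ G) (q *ₚ G) a ⟨
      G ^ₚ k *ₚ G +ₚ q *ₚ G +ₚ a        P.≈⟨ P.+-congʳ (P.distribʳ G (G ^ₚ k) q) ⟨
      (G ^ₚ k +ₚ q) *ₚ G +ₚ a           P.∎

  -- Both powers are monic of degree deg f · deg F, so the leading terms cancel.
  gap : MonicPoly K → MonicPoly K → Poly K
  gap f F = poly f ^ₚ degree F +ₚ -ₚ (poly F ^ₚ degree f)

  gap-below : ∀ f F → DegreeBelow (degree F ℕ.* degree f) (gap f F)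
  gap-below f F = below-difference (poly f ^ₚ degree F) (poly F ^ₚ degree f)
    (leading-^ (poly f) (leading-monic f) (degree F))
    (≡.subst (λ m → Leading (poly F ^ₚ degree f) m K.1#) (ℕₚ.*-comm (degree f) (degree F))
      (leading-^ (poly F) (leading-monic F) (degree f)))

  gap-+ : ∀ f F → poly F ^ₚ degree f +ₚ gap f F ≋ poly f ^ₚ degree F
  gap-+ f F = P.trans (P.+-comm b (gap f F)) (P.//-rightDividesˡ b a)
    where
    a = poly f ^ₚ degree F
    b = poly F ^ₚ degree f

  -- The power f ^ deg F is monic of degree deg f · deg F, so its value is at most that of F ^ deg
  -- f.
  slope-≤ : ∀ μ f F → Expands μ F → slope μ f ≤⁺ slope μ F
  slope-≤ μ f F ex = cross⇒/∞-≤ (degree f) (degree F) {{degree≢0 f}} {{degree≢0 F}} (begin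
    degree F · w μ (poly f)               ≡⟨ w-^ μ (poly f) (degree F) ⟨
    w μ (poly f ^ₚ degree F)              ≡⟨ w-cong μ (gap-+ f F) ⟨
    w μ (poly F ^ₚ degree f +ₚ gap f F)
      ≤⟨ expands-power μ F ex (degree f) (gap f F)
           (≡.subst (λ m → DegreeBelow m (gap f F)) (ℕₚ.*-comm (degree F) (degree f)) (gap-below f F)) ⟩
    degree f · w μ (poly F)               ∎)
    where open ≤⁺-Reasoning

  module _ (μ ν : PseudoValuation) (φ : MonicPoly K) (expands : Expands μ φ)
           (digits : ∀ a → DegreeBelow (degree φ) a → w μ a ≤⁺ w ν a) where
    open ≤⁺-Reasoning

    -- Passing from μ to ν costs nothing on the digits and at most δ for each factor φ; the terms of
    -- the φ-expansion of g contain at most m such factors.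
    digitwise-≤ : ∀ δ → 0ℚ ℚ.≤ δ → w μ (poly φ) ≤⁺ w ν (poly φ) +∞ [ δ ] →
                  ∀ m g → DegreeBelow (m ℕ.* degree φ ℕ.+ degree φ) g → w μ g ≤⁺ w ν g +∞ m · [ δ ]
    digitwise-≤ δ 0≤δ φ≤ zero    g bg = ≡.subst (w μ g ≤⁺_) (≡.sym (+∞-identityʳ (w ν g))) (digits g bg)
    digitwise-≤ δ 0≤δ φ≤ (suc m) g bg
      with divide (poly φ) (degree φ) (leading-monic φ) (degree φ ℕ.+ m ℕ.* degree φ) g bg
    ... | q , a , e , ba , bq = ≤⁺-trans
          (⊓∞-elim (λ γ → w μ g ≤⁺ γ +∞ suc m · [ δ ]) via-quotient via-remainder)
          (+∞-mono-≤ (≡.subst (w ν (q *ₚ poly φ) ⊓∞ w ν a ≤⁺_) (w-cong ν (P.sym e)) (w-+ ν (q *ₚ poly φ) a)) ≤⁺-refl)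
      where
      via-quotient : w μ g ≤⁺ w ν (q *ₚ poly φ) +∞ suc m · [ δ ]
      via-quotient = begin
        w μ g                                                     ≡⟨ w-cong μ e ⟩
        w μ (q *ₚ poly φ +ₚ a)                                    ≤⟨ expands-quotient μ φ expands q a ba ⟩
        w μ q +∞ w μ (poly φ)
          ≤⟨ +∞-mono-≤ (digitwise-≤ δ 0≤δ φ≤ m q
               (≡.subst (λ k → DegreeBelow k q) (ℕₚ.+-comm (degree φ) (m ℕ.* degree φ)) bq)) φ≤ ⟩
        (w ν q +∞ m · [ δ ]) +∞ (w ν (poly φ) +∞ [ δ ])           ≡⟨ +∞-interchange (w ν q) (m · [ δ ]) (w ν (poly φ)) [ δ ] ⟩
        (w ν q +∞ w ν (poly φ)) +∞ (m · [ δ ] +∞ [ δ ])           ≡⟨ ≡.cong₂ _+∞_ (≡.sym (w-* ν q (poly φ))) (+∞-comm (m · [ δ ]) [ δ ]) ⟩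
        w ν (q *ₚ poly φ) +∞ suc m · [ δ ]                        ∎
      via-remainder : w μ g ≤⁺ w ν a +∞ suc m · [ δ ]
      via-remainder = begin
        w μ g                             ≡⟨ w-cong μ e ⟩
        w μ (q *ₚ poly φ +ₚ a)            ≤⟨ expands q a ba ⟩
        w μ a                             ≤⟨ digits a ba ⟩
        w ν a                             ≤⟨ ≤⁺-+∞-·ʳ (suc m) (w ν a) 0≤δ ⟩
        w ν a +∞ suc m · [ δ ]            ∎

    -- If ν(φ) < μ(φ), then φ ^ deg F would be the dominant term of F ^ deg φ at ν.
    φ-dominated : ∀ F → (∃[ κ ] w μ (poly φ) ≡ [ κ ]) → slope μ φ ≤⁺ slope μ F → w ν (poly F) ≡ ∞ →
                  w μ (poly φ) ≤⁺ w ν (poly φ)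
    φ-dominated F (κ , μφ≡κ) slopes νF≡∞ with ≤⁺⊎>⁺ (w μ (poly φ)) (w ν (poly φ))
    ... | inj₁ le = le
    ... | inj₂ lt with <⁺-finite lt
    ... | σ , νφ≡σ = contradiction
          (<⁺-≤⁺-trans strictly σ-bound) <⁺-irrefl
      where
      d = degree φ
      n = degree F
      -- The degree of the gap is less than n d, so its terms contain at most n - 1 factors φ and
      -- lose at most (n - 1) δ. As φ ^ n loses exactly n δ, a strict margin of δ remains.
      m = ℕ.pred n
      δ = κ ℚ.- σ
      n≡1+m : n ≡ suc m
      n≡1+m = ≡.sym (ℕₚ.suc-pred n {{degree≢0 F}})
      σ<κ : σ ℚ.< κ
      σ<κ with ≡.subst₂ _<⁺_ νφ≡σ μφ≡κ lt
      ... | [ h ]< = h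
      κ≡σ+δ : κ ≡ σ ℚ.+ δ
      κ≡σ+δ = ≡.sym (≡.trans (≡.cong (σ ℚ.+_) (ℚₚ.+-comm κ (ℚ.- σ))) (≡.trans (≡.sym (ℚₚ.+-assoc σ (ℚ.- σ) κ))
        (≡.trans (≡.cong (ℚ._+ κ) (ℚₚ.+-inverseʳ σ)) (ℚₚ.+-identityˡ κ))))
      0<δ : 0ℚ ℚ.< δ
      0<δ = ≡.subst (ℚ._< δ) (ℚₚ.+-inverseʳ σ) (ℚₚ.+-monoˡ-< (ℚ.- σ) σ<κ)
      nσ = ·-finite n σ
      mδ = ·-finite m δ
      R = gap F φ
      strictly : [ proj₁ nσ ] <⁺ n · [ σ ] +∞ [ δ ]
      strictly = ≡.subst (λ γ → [ proj₁ nσ ] <⁺ γ +∞ [ δ ]) (≡.sym (proj₂ nσ)) (<⁺-+∞ʳ (proj₁ nσ) 0<δ)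
      R-below : DegreeBelow (m ℕ.* d ℕ.+ d) R
      R-below = ≡.subst (λ k → DegreeBelow k R)
        (≡.trans (≡.trans (ℕₚ.*-comm d n) (≡.cong (ℕ._* d) n≡1+m)) (ℕₚ.+-comm d (m ℕ.* d))) (gap-below F φ)
      -- The comparison of slopes says that the value of F ^ d at μ is at least that of φ ^ n, and R
      -- is their difference.
      nφ≤R : n · w μ (poly φ) ≤⁺ w μ R
      nφ≤R = ≤-w-+ μ (poly F ^ₚ d) (-ₚ (poly φ ^ₚ n))
        (≡.subst (n · w μ (poly φ) ≤⁺_) (≡.sym (w-^ μ (poly F) d)) (/∞-≤⇒cross d n {{degree≢0 φ}} {{degree≢0 F}} slopes))
        (≤⁺-reflexive (≡.sym (≡.trans (w-neg μ (poly φ ^ₚ n)) (w-^ μ (poly φ) n))))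
      regroup : (n · [ σ ] +∞ [ δ ]) +∞ m · [ δ ] ≡ n · w μ (poly φ)
      regroup = begin-equality
        (n · [ σ ] +∞ [ δ ]) +∞ m · [ δ ]   ≡⟨ +∞-assoc (n · [ σ ]) [ δ ] (m · [ δ ]) ⟩
        n · [ σ ] +∞ suc m · [ δ ]          ≡⟨ ≡.cong (λ k → n · [ σ ] +∞ k · [ δ ]) n≡1+m ⟨
        n · [ σ ] +∞ n · [ δ ]              ≡⟨ ·-distrib-+∞ n [ σ ] [ δ ] ⟨
        n · [ σ ℚ.+ δ ]                     ≡⟨ ≡.cong (λ γ → n · [ γ ]) κ≡σ+δ ⟨
        n · [ κ ]                           ≡⟨ ≡.cong (n ·_) μφ≡κ ⟨
        n · w μ (poly φ)                    ∎
      R-bound : n · [ σ ] +∞ [ δ ] ≤⁺ w ν R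
      R-bound = +∞-cancelʳ-≤ (proj₁ mδ) (≡.subst (λ γ → n · [ σ ] +∞ [ δ ] +∞ γ ≤⁺ w ν R +∞ γ) (proj₂ mδ) (begin
        (n · [ σ ] +∞ [ δ ]) +∞ m · [ δ ]   ≡⟨ regroup ⟩
        n · w μ (poly φ)                    ≤⟨ nφ≤R ⟩
        w μ R                               ≤⟨ digitwise-≤ δ (ℚₚ.<⇒≤ 0<δ) (≤⁺-reflexive (≡.trans μφ≡κ (≡.trans (≡.cong [_] κ≡σ+δ) (≡.cong (_+∞ [ δ ]) (≡.sym νφ≡σ))))) m R R-below ⟩
        w ν R +∞ m · [ δ ]                  ∎))
      -- As φ ^ n + R = F ^ d has the value ∞ at ν, the lower bound for R carries over to φ ^ n,
      -- whose value is only n σ.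
      σ-bound : n · [ σ ] +∞ [ δ ] ≤⁺ [ proj₁ nσ ]
      σ-bound = ≡.subst (n · [ σ ] +∞ [ δ ] ≤⁺_) (≡.trans (w-^ ν (poly φ) n) (≡.trans (≡.cong (n ·_) νφ≡σ) (proj₂ nσ)))
        (≤-w-cancelʳ ν (poly φ ^ₚ n) R (≡.subst (n · [ σ ] +∞ [ δ ] ≤⁺_) (≡.sym νF^d≡∞) (_ ≤⊤)) R-bound)
        where
        νF^d≡∞ : w ν (poly φ ^ₚ n +ₚ R) ≡ ∞
        νF^d≡∞ = ≡.trans (w-cong ν (gap-+ F φ)) (≡.trans (w-^ ν (poly F) d)
          (≡.trans (≡.cong (d ·_) νF≡∞) (·-∞ d {{degree≢0 φ}})))

    -- This is the case δ = 0, where the crude bound `length g` for the number of digits does no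
    -- harm.
    dominates : w μ (poly φ) ≤⁺ w ν (poly φ) → ∀ g → w μ g ≤⁺ w ν g
    dominates φ≤ g = ≡.subst (w μ g ≤⁺_) (≡.trans (≡.cong (w ν g +∞_) (·-zeroʳ (length g))) (+∞-identityʳ (w ν g)))
      (digitwise-≤ 0ℚ ℚₚ.≤-refl (≡.subst (w μ (poly φ) ≤⁺_) (≡.sym (+∞-identityʳ _)) φ≤) (length g) g
        (below-mono g (ℕₚ.≤-trans (ℕₚ.m≤m*n (length g) (degree φ) {{degree≢0 φ}}) (ℕₚ.m≤m+n _ (degree φ))) (below-length g)))

  -- Key polynomials

  -- Encodes that H(F) divides no product H(a) H(b) with deg a, deg b < deg F.
  KeyLike : PseudoValuation → MonicPoly K → Set (c ⊔ ℓ)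
  KeyLike μ F = ∀ a b q → DegreeBelow (degree F) a → DegreeBelow (degree F) b →
                w μ (a *ₚ b +ₚ q *ₚ poly F) ≤⁺ w μ (a *ₚ b)

  below-1ₚ : ∀ (F : MonicPoly K) → DegreeBelow (degree F) 1ₚ
  below-1ₚ F = below-mono 1ₚ (ℕ.>-nonZero⁻¹ (degree F) {{degree≢0 F}}) (below-length 1ₚ)

  -- The factor b = 1 is allowed, since F has positive degree.
  keyLike⇒expands : ∀ μ F → KeyLike μ F → Expands μ F
  keyLike⇒expands μ F key q a ba = ≡.subst₂ _≤⁺_
    (w-cong μ (P.trans (P.+-congʳ (P.*-identityʳ a)) (P.+-comm a (q *ₚ poly F))))
    (w-cong μ (P.*-identityʳ a))
    (key a 1ₚ q ba (below-1ₚ F))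

  Definite : PseudoValuation → Set (c ⊔ ℓ)
  Definite μ = ∀ {g} → w μ g ≡ ∞ → g ≋ 0ₚ

  monic-finite : ∀ μ → Definite μ → ∀ (f : MonicPoly K) → ∃[ p ] w μ (poly f) ≡ [ p ]
  monic-finite μ def f with finite? (w μ (poly f))
  ... | inj₂ fin = fin
  ... | inj₁ e   = contradiction
        (K.trans (K.sym (coeff-degree f)) (at (def e) (degree f))) (Field.1≉0 K)

  restriction-definite : ∀ μ → Definite (restriction μ)
  restriction-definite μ {g} e = coeffwise
    (IsRationalFunctionField.transcendental isRationalFunctionField g (Valuation.val-∞ (valuation μ) e))

  -- Agreement in degrees below a key polynomial

  module _ (μ ν : PseudoValuation) (μ≤ν : ∀ g → w μ g ≤⁺ w ν g) (definite : Definite μ)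
           (F : MonicPoly K) (key : KeyLike μ F) (μF<νF : w μ (poly F) <⁺ w ν (poly F)) where
    private
      open ValuationProperties v using (≈0?)
      n = degree F

      scaling : ∀ b → (∃[ β ] val v b ≡ [ β ]) → ∀ g → w μ g <⁺ w ν g →
                w μ ((b ∷ []) *ₚ g) <⁺ w ν ((b ∷ []) *ₚ g)
      scaling b (β , e) g lt = ≡.subst₂ _<⁺_ (≡.sym (scaled μ)) (≡.sym (scaled ν)) (+∞-mono-≤-< {β} {[ β ]} ≤⁺-refl lt)
        where
        scaled : ∀ ρ → w ρ ((b ∷ []) *ₚ g) ≡ [ β ] +∞ w ρ g
        scaled ρ = ≡.trans (w-* ρ (b ∷ []) g) (≡.cong (_+∞ w ρ g) (≡.trans (w-const ρ b) e))

      -- Write F = q g + t. By `KeyLike`, μ(t) = μ(q g - F) is at most μ(q g), hence also at most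
      -- μ(F). Both q g and F have larger values at ν than at μ, so μ(t) < ν(t), although t has
      -- degree less than k.
      monic-step : ∀ k → k ℕ.< n → .{{_ : NonZero k}} → (∀ t → DegreeBelow k t → w ν t ≤⁺ w μ t) →
                   ∀ g → Leading g k K.1# → ¬ w μ g <⁺ w ν g
      monic-step k k<n rec g lg lt
        with divide g k lg (suc n ℕ.∸ k) (poly F)
               (≡.subst (λ m → DegreeBelow m (poly F)) (≡.sym (ℕₚ.m∸n+n≡m (ℕₚ.≤-trans (ℕₚ.<⇒≤ k<n) (ℕₚ.n≤1+n n)))) (coeff-above F))
      ... | q , t , e , bt , bq = <⁺-irrefl (<⁺-≤⁺-trans μt<νt (rec t bt))
        where
        open ≤⁺-Reasoning
        -- Here k ≥ 1 is essential: division gives deg q < n + 1 - k, which has to be at most n.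
        q-below : DegreeBelow n q
        q-below = below-mono q (ℕₚ.∸-monoʳ-≤ (suc n) (ℕ.>-nonZero⁻¹ k)) bq
        -- With a finite μ(q), the inequality μ(g) < ν(g) remains strict after multiplication by q.
        -- For q = 0 the polynomial F would equal the remainder.
        q-finite : ∃[ p ] w μ q ≡ [ p ]
        q-finite with finite? (w μ q)
        ... | inj₂ fin = fin
        ... | inj₁ μq≡∞ = contradiction (K.trans (K.sym (coeff-degree F)) (K.trans (at F≋t n) (bt n (ℕₚ.<⇒≤ k<n)))) (Field.1≉0 K)
          where
          F≋t : poly F ≋ t
          F≋t = P.trans e (P.trans (P.+-congʳ (P.trans (P.*-congʳ (definite μq≡∞)) (P.zeroˡ g))) (P.+-identityˡ t))
        remainder : q *ₚ g +ₚ -ₚ 1ₚ *ₚ poly F ≋ -ₚ t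
        remainder = P.begin
          q *ₚ g +ₚ -ₚ 1ₚ *ₚ poly F            P.≈⟨ P.+-congˡ {q *ₚ g} (P.-1*x≈-x (poly F)) ⟩
          q *ₚ g +ₚ -ₚ (poly F)                P.≈⟨ P.+-congˡ {q *ₚ g} (P.-‿cong e) ⟩
          q *ₚ g +ₚ -ₚ (q *ₚ g +ₚ t)           P.≈⟨ P.+-congˡ {q *ₚ g} (P.-‿+-comm (q *ₚ g) t) ⟨
          q *ₚ g +ₚ (-ₚ (q *ₚ g) +ₚ -ₚ t)      P.≈⟨ P.+-assoc (q *ₚ g) (-ₚ (q *ₚ g)) (-ₚ t) ⟨
          q *ₚ g +ₚ -ₚ (q *ₚ g) +ₚ -ₚ t        P.≈⟨ P.+-congʳ (P.-‿inverseʳ (q *ₚ g)) ⟩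
          0ₚ +ₚ -ₚ t                            P.≈⟨ P.+-identityˡ (-ₚ t) ⟩
          -ₚ t                                  P.∎
        μt≤μqg : w μ t ≤⁺ w μ (q *ₚ g)
        μt≤μqg = begin
          w μ t                                    ≡⟨ w-neg μ t ⟨
          w μ (-ₚ t)                               ≡⟨ w-cong μ remainder ⟨
          w μ (q *ₚ g +ₚ -ₚ 1ₚ *ₚ poly F)
            ≤⟨ key q g (-ₚ 1ₚ) q-below (below-mono g k<n (below lg)) ⟩
          w μ (q *ₚ g)                             ∎
        μqg<νqg : w μ (q *ₚ g) <⁺ w ν (q *ₚ g)
        μqg<νqg = let p , μq≡p = q-finite in ≡.subst₂ _<⁺_
          (≡.trans (≡.cong (_+∞ w μ g) (≡.sym μq≡p)) (≡.sym (w-* μ q g))) (≡.sym (w-* ν q g))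
          (+∞-mono-≤-< {p} (≡.subst (_≤⁺ w ν q) μq≡p (μ≤ν q)) lt)
        μt<νF : w μ t <⁺ w ν (q *ₚ g +ₚ t)
        μt<νF = begin-strict
          w μ t                     ≤⟨ ≤-w-+ μ (q *ₚ g) t μt≤μqg ≤⁺-refl ⟩
          w μ (q *ₚ g +ₚ t)         ≡⟨ w-cong μ e ⟨
          w μ (poly F)              <⟨ μF<νF ⟩
          w ν (poly F)              ≡⟨ w-cong ν e ⟩
          w ν (q *ₚ g +ₚ t)         ∎
        μt<νt : w μ t <⁺ w ν t
        μt<νt = <-w-cancelˡ ν (q *ₚ g) t μt<νF (≤⁺-<⁺-trans μt≤μqg μqg<νqg)

      -- On constants both pseudo-valuations restrict to v. In positive degree g is made monic,
      -- which shifts both values by the same finite amount.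
      leading-step : ∀ k → k ℕ.< n → (∀ t → DegreeBelow k t → w ν t ≤⁺ w μ t) →
                     ∀ g → DegreeBelow (suc k) g → coeff g k K.≉ K.0# → w ν g ≤⁺ w μ g
      leading-step zero k<n rec g bg _ = ≤⁺-reflexive (≡.trans (constant ν) (≡.sym (constant μ)))
        where
        constant : ∀ ρ → w ρ g ≡ val v (coeff g 0)
        constant ρ = ≡.trans (w-cong ρ (constant-≋ g bg)) (w-const ρ (coeff g 0))
      leading-step k@(suc _) k<n rec g bg c≉0 with ≤⁺⊎>⁺ (w ν g) (w μ g)
      ... | inj₁ le = le
      ... | inj₂ lt with Field.invertible K (coeff g k) c≉0
      ... | b , cb≈1 = contradiction (scaling b b-finite g lt)
            (monic-step k k<n rec ((b ∷ []) *ₚ g)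
              (leading-cong (λ _ → K.refl) (K.trans (K.*-comm b (coeff g k)) cb≈1)
                (leading-* (b ∷ []) g (leading-const b) (K.refl , bg))))
        where
        b-finite : ∃[ β ] val v b ≡ [ β ]
        b-finite with finite? (val v b)
        ... | inj₂ fin = fin
        ... | inj₁ e   = contradiction
              (K.trans (K.sym cb≈1) (K.trans (K.*-congˡ (Valuation.val-∞ v e)) (K.zeroʳ (coeff g k)))) (Field.1≉0 K)

      agree : ∀ k → k ℕ.≤ n → ∀ g → DegreeBelow k g → w ν g ≤⁺ w μ g
      agree zero    k≤n g bg = ≡.subst (w ν g ≤⁺_) (≡.sym (≡.trans (w-cong μ g≋0) (w-0 μ))) (_ ≤⊤)
        where
        g≋0 : g ≋ 0ₚ
        g≋0 = coeffwise λ i → bg i ℕ.z≤n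
      agree (suc k) k<n g bg with ≈0? (coeff g k)
      ... | yes c≈0 = agree k (ℕₚ.<⇒≤ k<n) g (below-suc g bg c≈0)
      ... | no  c≉0 = leading-step k k<n (agree k (ℕₚ.<⇒≤ k<n)) g bg c≉0

    agree-below : ∀ g → DegreeBelow (degree F) g → w ν g ≡ w μ g
    agree-below g bg = ≤⁺-antisym (agree n ℕₚ.≤-refl g bg) (μ≤ν g)

  -- From prime initial forms to inequalities of values

  module _ (μ : 𝕍) where
    open GradedAlgebra μ
    private
      -- `H` splits on the value of g; a known value e resolves that split, so that `H g` becomes an
      -- explicit list.
      H≡initial : ∀ g {γ} (e : μ ⟪ g ⟫ ≡ γ) → H g ≡ initial g γ e
      H≡initial g refl = refl

      ⟪[]⟫ : μ ⟪ [] ⟫ ≡ ∞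
      ⟪[]⟫ = Valuation.val-0 (valuation μ)

      nonzero : ∀ g {p} → μ ⟪ g ⟫ ≡ [ p ] → g ≉ₚ 0ₚ
      nonzero g e g≈0 = contradiction
        (≡.trans (≡.sym e) (≡.trans (w-cong (restriction μ) {g} {[]} (coeffwise g≈0)) ⟪[]⟫)) λ ()

    -- The cofactor is the initial form of q: the products q F and a b have the same value and agree
    -- modulo larger values, so H(q) H(F) = H(a) H(b).
    H-divides : ∀ a b q F {α β γ δ} → μ ⟪ a ⟫ ≡ [ α ] → μ ⟪ b ⟫ ≡ [ β ] → μ ⟪ q ⟫ ≡ [ γ ] → μ ⟪ F ⟫ ≡ [ δ ] →
                γ ℚ.+ δ ≡ α ℚ.+ β → [ α ℚ.+ β ] <⁺ μ ⟪ q *ₚ F +ₚ -ₚ (a *ₚ b) ⟫ →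
                H F ∣ List.cartesianProductWith _*ʰ_ (H a) (H b)
    H-divides a b q F {α} {β} {γ} {δ} ea eb eq eF grades lt
      rewrite H≡initial a ea | H≡initial b eb | H≡initial F eF =
      record { quotient = initial q [ γ ] eq ; equality = components }
      where
      components : List.cartesianProductWith _*ʰ_ (initial q [ γ ] eq) (initial F [ δ ] eF) ≈ᴳ
                   List.cartesianProductWith _*ʰ_ (initial a [ α ] ea) (initial b [ β ] eb)
      -- Each product is a formal sum with one term. In its own grade the claim is the hypothesis,
      -- in any other grade both components are empty, and the mixed cases contradict the equality
      -- of the two grades.
      components ε with γ ℚ.+ δ ℚₚ.≟ ε | α ℚ.+ β ℚₚ.≟ ε
      ... | yes _    | yes refl = ≡.subst ([ ε ] <⁺_)
              (w-cong (restriction μ) (P.sym (P.+-cong (P.+-identityʳ (q *ₚ F)) (P.-‿cong (P.+-identityʳ (a *ₚ b)))))) lt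
      ... | no  _    | no  _    = ≡.subst ([ ε ] <⁺_) (≡.sym ⟪[]⟫) [ ε ]<⊤
      ... | yes refl | no  ne   = contradiction (≡.sym grades) ne
      ... | no  ne   | yes refl = contradiction grades ne

    +∞-finite : ∀ α β {p} → α +∞ β ≡ [ p ] → ∃[ a ] ∃[ b ] α ≡ [ a ] × β ≡ [ b ] × a ℚ.+ b ≡ p
    +∞-finite [ a ] [ b ] refl = a , b , refl , refl , refl
    +∞-finite [ a ] ∞     ()
    +∞-finite ∞     β     ()

    -- If the value of a b + q F were larger than that of a b, then a b and -q F would have the same
    -- initial form. By primality H(F) would divide H(a) or H(b), against the minimality of F.
    keyPolynomial⇒keyLike : ∀ F → IsKeyPolynomial μ F → KeyLike (restriction μ) F
    keyPolynomial⇒keyLike F key a b q ba bb with ≤⁺⊎>⁺ (ν (a *ₚ b +ₚ q *ₚ poly F)) (ν (a *ₚ b))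
      where ν = w (restriction μ)
    ... | inj₁ le = le
    ... | inj₂ lt with <⁺-finite lt
    ... | p , ab≡p with +∞-finite (μ ⟪ a ⟫) (μ ⟪ b ⟫) (≡.trans (≡.sym (⟪⟫-* a b)) ab≡p)
       | +∞-finite (μ ⟪ -ₚ q ⟫) (μ ⟪ poly F ⟫) (≡.trans (≡.sym (w-* (restriction μ) (-ₚ q) (poly F)))
           (≡.trans (w-cong (restriction μ) (P.sym (P.-‿distribˡ-* q (poly F))))
             (≡.trans (w-neg (restriction μ) (q *ₚ poly F)) (≡.trans (w-absorb (restriction μ) (a *ₚ b) (q *ₚ poly F) lt) ab≡p))))
    ... | α , β , ea , eb , refl | γ , δ , eq , eF , γ+δ≡p
        with Prime.split-∣ (IsKeyPolynomial.prime key) {H a} {H b} (H-divides a b (-ₚ q) (poly F) ea eb eq eF γ+δ≡p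
               (≡.subst₂ _<⁺_ ab≡p (≡.trans (≡.sym (w-neg (restriction μ) (a *ₚ b +ₚ q *ₚ poly F))) (w-cong (restriction μ) regroup)) lt))
      where
      regroup : -ₚ (a *ₚ b +ₚ q *ₚ poly F) ≋ -ₚ q *ₚ poly F +ₚ -ₚ (a *ₚ b)
      regroup = P.trans (P.sym (P.-‿+-comm (a *ₚ b) (q *ₚ poly F)))
        (P.trans (P.+-comm (-ₚ (a *ₚ b)) (-ₚ (q *ₚ poly F))) (P.+-congʳ (P.-‿distribˡ-* q (poly F))))
    ... | inj₁ F∣a = contradiction F∣a (IsKeyPolynomial.minimal key a (nonzero a ea) ba)
    ... | inj₂ F∣b = contradiction F∣b (IsKeyPolynomial.minimal key b (nonzero b eb) bb)

  -- Augmented valuations and the Gauss valuation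

  fromExpansion-suc : ∀ φ s gs → fromExpansion φ (suc s) gs ≋ fromExpansion φ s gs *ₚ φ
  fromExpansion-suc φ s []       = P.refl
  fromExpansion-suc φ s (g ∷ gs) = P.begin
    g *ₚ (φ *ₚ φ ^ₚ s) +ₚ fromExpansion φ (suc (suc s)) gs     P.≈⟨ P.+-cong (P.*-congˡ {g} (P.*-comm φ (φ ^ₚ s))) (fromExpansion-suc φ (suc s) gs) ⟩
    g *ₚ (φ ^ₚ s *ₚ φ) +ₚ fromExpansion φ (suc s) gs *ₚ φ      P.≈⟨ P.+-congʳ (P.*-assoc g (φ ^ₚ s) φ) ⟨
    g *ₚ φ ^ₚ s *ₚ φ +ₚ fromExpansion φ (suc s) gs *ₚ φ        P.≈⟨ P.distribʳ φ (g *ₚ φ ^ₚ s) (fromExpansion φ (suc s) gs) ⟨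
    (g *ₚ φ ^ₚ s +ₚ fromExpansion φ (suc s) gs) *ₚ φ           P.∎

  -- This is the Horner form of an expansion, in which the first digit is the remainder of one
  -- division by φ.
  fromExpansion-∷ : ∀ φ a gs → fromExpansion φ 0 (a ∷ gs) ≋ fromExpansion φ 0 gs *ₚ φ +ₚ a
  fromExpansion-∷ φ a gs = P.trans (P.+-cong (P.*-identityʳ a) (fromExpansion-suc φ 0 gs)) (P.+-comm a _)

  expansion : ∀ (φ : MonicPoly K) m g → DegreeBelow (m ℕ.* degree φ) g →
              ∃[ gs ] All (DegreeBelow (degree φ)) gs × (fromExpansion (poly φ) 0 gs ≋ g)
  expansion φ zero    g bg = [] , [] , coeffwise λ i → K.sym (bg i ℕ.z≤n)
  expansion φ (suc m) g bg
    with divide (poly φ) (degree φ) (leading-monic φ) (m ℕ.* degree φ) g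
           (≡.subst (λ k → DegreeBelow k g) (ℕₚ.+-comm (degree φ) _) bg)
  ... | q , a , e , ba , bq with expansion φ m q bq
  ... | gs , bgs , gs≋q = a ∷ gs , ba ∷ bgs ,
        P.trans (fromExpansion-∷ (poly φ) a gs) (P.trans (P.+-congʳ (P.*-congʳ gs≋q)) (P.sym e))

  module _ (μ : 𝕍) (φ : MonicPoly K) (λ′ : ℚ) (μ′ : 𝕍) (aug : IsAugmentation μ φ λ′ μ′) where
    private
      ν  = w (restriction μ)
      ν′ = w (restriction μ′)
      -- The left-hand side is the term of exponent 0 in `augmentedVal`.
      +0·λ : ∀ a → ν (a *ₚ 1ₚ) +∞ [ (+ 0 ℚ./ 1) ℚ.* λ′ ] ≡ ν a
      +0·λ a = ≡.trans (≡.cong₂ (λ α β → α +∞ [ β ]) (w-cong (restriction μ) (P.*-identityʳ a)) (ℚₚ.*-zeroˡ λ′))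
        (+∞-identityʳ (ν a))

    augmentation-below : ∀ a → DegreeBelow (degree φ) a → ν′ a ≡ ν a
    augmentation-below a ba = begin
      ν′ a                                                      ≡⟨ w-cong (restriction μ′) (P.trans (P.+-identityʳ (a *ₚ 1ₚ)) (P.*-identityʳ a)) ⟨
      ν′ (fromExpansion (poly φ) 0 (a ∷ []))                    ≡⟨ aug (a ∷ []) (ba ∷ []) ⟩
      (ν (a *ₚ 1ₚ) +∞ [ (+ 0 ℚ./ 1) ℚ.* λ′ ]) ⊓∞ ∞              ≡⟨ ⊓∞-identityʳ _ ⟩
      ν (a *ₚ 1ₚ) +∞ [ (+ 0 ℚ./ 1) ℚ.* λ′ ]                     ≡⟨ +0·λ a ⟩
      ν a                                                       ∎
      where open ≡.≡-Reasoning

    -- The φ-expansion of φ has the digits 0 and 1, and only the second contributes a finite value.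
    augmentation-φ : ν′ (poly φ) ≡ ν (poly φ) +∞ [ λ′ ]
    augmentation-φ = begin
      ν′ (poly φ)                                               ≡⟨ w-cong (restriction μ′) φ≋ ⟨
      ν′ (fromExpansion (poly φ) 0 (0ₚ ∷ 1ₚ ∷ []))              ≡⟨ aug (0ₚ ∷ 1ₚ ∷ []) ((λ _ _ → K.refl) ∷ below-1ₚ φ ∷ []) ⟩
      (ν (0ₚ *ₚ 1ₚ) +∞ [ (+ 0 ℚ./ 1) ℚ.* λ′ ]) ⊓∞ (α ⊓∞ ∞)      ≡⟨ ≡.cong₂ _⊓∞_ (≡.trans (+0·λ 0ₚ) (w-0 (restriction μ))) (⊓∞-identityʳ α) ⟩
      α                                                         ≡⟨ ≡.cong₂ (λ γ δ → γ +∞ [ δ ]) (w-cong (restriction μ) (P.trans (P.*-identityˡ _) (P.*-identityʳ (poly φ)))) (ℚₚ.*-identityˡ λ′) ⟩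
      ν (poly φ) +∞ [ λ′ ]                                      ∎
      where
      open ≡.≡-Reasoning
      α = ν (1ₚ *ₚ poly φ ^ₚ 1) +∞ [ (+ 1 ℚ./ 1) ℚ.* λ′ ]
      φ≋ : fromExpansion (poly φ) 0 (0ₚ ∷ 1ₚ ∷ []) ≋ poly φ
      φ≋ = P.trans (fromExpansion-∷ (poly φ) 0ₚ (1ₚ ∷ [])) (P.trans (P.+-identityʳ _)
        (P.trans (P.*-congʳ (P.trans (P.+-identityʳ (1ₚ *ₚ 1ₚ)) (P.*-identityˡ 1ₚ))) (P.*-identityˡ (poly φ))))

    -- The remainder a is the digit of exponent 0 of q φ + a, so its value is among those whose
    -- minimum is taken.
    augmentation-expands : Expands (restriction μ′) φ
    augmentation-expands q a ba
      with expansion φ (length q) q (below-mono q (ℕₚ.m≤m*n (length q) (degree φ) {{degree≢0 φ}}) (below-length q))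
    ... | gs , bgs , gs≋q = begin
      ν′ (q *ₚ poly φ +ₚ a)                     ≡⟨ w-cong (restriction μ′) (P.trans (fromExpansion-∷ (poly φ) a gs) (P.+-congʳ (P.*-congʳ gs≋q))) ⟨
      ν′ (fromExpansion (poly φ) 0 (a ∷ gs))    ≡⟨ aug (a ∷ gs) (ba ∷ bgs) ⟩
      augmentedVal μ (poly φ) λ′ 0 (a ∷ gs)     ≤⟨ ⊓∞≤ˡ _ _ ⟩
      ν (a *ₚ 1ₚ) +∞ [ (+ 0 ℚ./ 1) ℚ.* λ′ ]     ≡⟨ +0·λ a ⟩
      ν a                                       ≡⟨ augmentation-below a ba ⟨
      ν′ a                                      ∎
      where open ≤⁺-Reasoning

  X : MonicPoly K
  X = record
    { poly         = K.0# ∷ K.1# ∷ []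
    ; degree       = 1
    ; degree≢0     = _
    ; coeff-degree = K.refl
    ; coeff-above  = λ { (suc zero) (ℕ.s≤s ()) ; (suc (suc n)) _ → K.refl }
    }

  minCoeffVal-≤ : ∀ g n → minCoeffVal g ≤⁺ val v (coeff g n)
  minCoeffVal-≤ []      n       = ≡.subst (∞ ≤⁺_) (≡.sym (Valuation.val-0 v)) ≤⁺-refl
  minCoeffVal-≤ (a ∷ g) zero    = ⊓∞≤ˡ _ _
  minCoeffVal-≤ (a ∷ g) (suc n) = ≤⁺-trans (⊓∞≤ʳ (val v a) _) (minCoeffVal-≤ g n)

  module _ (μ₀ : 𝕍) (gauss : IsGauss μ₀) where
    private
      ν = w (restriction μ₀)

    gauss-X : ν (poly X) ≡ [ 0ℚ ]
    gauss-X = ≡.trans (gauss (poly X))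
      (≡.cong₂ (λ α β → α ⊓∞ (β ⊓∞ ∞)) (Valuation.val-0 v) (Valuation.val-1 v))

    gauss-integral : ∀ g → [ 0ℚ ] ≤⁺ ν g → IntegralPoly g
    gauss-integral g 0≤g n = ≤⁺-trans (≡.subst ([ 0ℚ ] ≤⁺_) (gauss g) 0≤g) (minCoeffVal-≤ g n)

    -- The remainder is a constant, equal to the constant coefficient of the dividend, and the Gauss
    -- valuation is at most the value of each coefficient.
    gauss-expands : Expands (restriction μ₀) X
    gauss-expands q a ba = begin
      ν (q *ₚ poly X +ₚ a)                      ≡⟨ w-cong (restriction μ₀) (P.+-congʳ (P.*-comm q (poly X))) ⟩
      ν (poly X *ₚ q +ₚ a)                      ≡⟨ gauss (poly X *ₚ q +ₚ a) ⟩
      minCoeffVal (poly X *ₚ q +ₚ a)            ≤⟨ minCoeffVal-≤ (poly X *ₚ q +ₚ a) 0 ⟩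
      val v (coeff (poly X *ₚ q +ₚ a) 0)        ≡⟨ Valuation.val-cong v constant ⟩
      val v (coeff a 0)                         ≡⟨ w-const (restriction μ₀) (coeff a 0) ⟨
      ν (coeff a 0 ∷ [])                        ≡⟨ w-cong (restriction μ₀) (constant-≋ a ba) ⟨
      ν a                                       ∎
      where
      open ≤⁺-Reasoning
      constant : coeff (poly X *ₚ q +ₚ a) 0 K.≈ coeff a 0
      constant = K.trans (coeff-+ (poly X *ₚ q) a 0) (K.trans (K.+-congʳ
        (K.trans (coeff-+ (scale K.0# q) _ 0) (K.trans (K.+-congʳ (K.trans (coeff-scale K.0# q 0) (K.zeroˡ _))) (K.+-identityˡ _))))
        (K.+-identityˡ _))

  -- MacLane chains and Okutsu frames

  module _ {μ : 𝕍} {r : ℕ} (chain : MacLaneChain μ r) (optimal : IsOptimal chain)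
           (F : MonicPoly K) (keyF : IsKeyPolynomial μ F) (strong : IsStrong chain F) where
    private
      Φ  = lookup (φs chain)
      F̂  = mapMonic ι̂ F
      top-index = fromℕ r

    νs : Fin (suc r) → PseudoValuation
    νs i = restriction (μs chain i)

    -- x is to the Gauss valuation what φᵢ is to μᵢ.
    ψ : Fin (suc r) → MonicPoly K
    ψ = lookup (X ∷ φs chain)

    -- Index i holds the key polynomial for μᵢ, which is φᵢ₊₁ for i < r and F for i = r.
    nextKey : Fin (suc r) → MonicPoly K
    nextKey = lookup (φs chain ∷ʳ F)

    nextKey-inject₁ : ∀ j → nextKey (inject₁ j) ≡ Φ j
    nextKey-inject₁ = lookup-∷ʳ-inject₁ (φs chain) F

    nextKey-top : nextKey top-index ≡ F
    nextKey-top = lookup-∷ʳ-fromℕ (φs chain) F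

    nextKey-keyLike : ∀ i → KeyLike (νs i) (nextKey i)
    nextKey-keyLike i with view i
    ... | ‵inject₁ j = ≡.subst (KeyLike (νs (inject₁ j))) (≡.sym (nextKey-inject₁ j))
                         (keyPolynomial⇒keyLike (μs chain (inject₁ j)) (Φ j) (key chain j))
    -- The polynomial F is a key polynomial for μ, which has the same values as the last valuation
    -- of the chain.
    ... | ‵fromℕ     = ≡.subst (KeyLike (νs top-index)) (≡.sym nextKey-top) λ a b q ba bb →
                         ≡.subst₂ _≤⁺_ (≡.sym (finish chain _)) (≡.sym (finish chain _))
                           (keyPolynomial⇒keyLike μ F keyF a b q ba bb)

    ψ-expands : ∀ i → Expands (νs i) (ψ i)
    ψ-expands zero    = gauss-expands (μs chain zero) (start chain)
    ψ-expands (suc j) = augmentation-expands (μs chain (inject₁ j)) (Φ j) _ (μs chain (suc j)) (augment chain j)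

    slope-≤-nextKey : ∀ i f → slope (νs i) f ≤⁺ slope (νs i) (nextKey i)
    slope-≤-nextKey i f = slope-≤ (νs i) f (nextKey i) (keyLike⇒expands (νs i) (nextKey i) (nextKey-keyLike i))

    slope-≤-ψ : ∀ i f → slope (νs i) f ≤⁺ slope (νs i) (ψ i)
    slope-≤-ψ i f = slope-≤ (νs i) f (ψ i) (ψ-expands i)

    νs-finite : ∀ i f → ∃[ p ] w (νs i) (poly f) ≡ [ p ]
    νs-finite i = monic-finite (νs i) (restriction-definite (μs chain i))

    augmented-Φ : ∀ j → w (νs (suc j)) (poly (Φ j)) ≡ w (νs (inject₁ j)) (poly (Φ j)) +∞ [ lookup (λs chain) j ]
    augmented-Φ j = augmentation-φ (μs chain (inject₁ j)) (Φ j) _ (μs chain (suc j)) (augment chain j)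

    augmented-below : ∀ j a → DegreeBelow (degree (Φ j)) a → w (νs (suc j)) a ≡ w (νs (inject₁ j)) a
    augmented-below j = augmentation-below (μs chain (inject₁ j)) (Φ j) _ (μs chain (suc j)) (augment chain j)

    -- Let φ be `Φ j`, n = deg f and d = deg φ. On leaving the augmented valuation φ ^ n loses
    -- exactly n λ, while f ^ d, of the same degree, loses at most n λ; so f keeps at least the
    -- slope of φ. Before the augmentation φ has the largest slope, as the key polynomial used
    -- there.
    maximal-slope-descends : ∀ j f → slope (νs (suc j)) (ψ (suc j)) ≤⁺ slope (νs (suc j)) f →
                             slope (νs (inject₁ j)) (ψ (inject₁ j)) ≤⁺ slope (νs (inject₁ j)) f
    maximal-slope-descends j f slopes = ≤⁺-trans
      (≡.subst (λ φ → slope ν (ψ (inject₁ j)) ≤⁺ slope ν φ) (nextKey-inject₁ j) (slope-≤-nextKey (inject₁ j) (ψ (inject₁ j))))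
      (cross⇒/∞-≤ d n {{degree≢0 (Φ j)}} {{degree≢0 f}} (+∞-cancelʳ-≤ (proj₁ nλ)
        (≡.subst (λ γ → n · w ν φ +∞ γ ≤⁺ d · w ν (poly f) +∞ γ) (proj₂ nλ) (begin
          n · w ν φ +∞ n · [ λⱼ ]         ≡⟨ ·-distrib-+∞ n (w ν φ) [ λⱼ ] ⟨
          n · (w ν φ +∞ [ λⱼ ])           ≡⟨ ≡.cong (n ·_) (augmented-Φ j) ⟨
          n · w ν′ φ                      ≤⟨ /∞-≤⇒cross d n {{degree≢0 (Φ j)}} {{degree≢0 f}} slopes ⟩
          d · w ν′ (poly f)               ≡⟨ w-^ ν′ (poly f) d ⟨
          w ν′ (poly f ^ₚ d)              ≤⟨ digits ⟩
          w ν (poly f ^ₚ d) +∞ n · [ λⱼ ] ≡⟨ ≡.cong (_+∞ n · [ λⱼ ]) (w-^ ν (poly f) d) ⟩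
          d · w ν (poly f) +∞ n · [ λⱼ ]  ∎))))
      where
      open ≤⁺-Reasoning
      ν  = νs (inject₁ j)
      ν′ = νs (suc j)
      φ  = poly (Φ j)
      d  = degree (Φ j)
      n  = degree f
      λⱼ = lookup (λs chain) j
      nλ = ·-finite n λⱼ
      f^d-below : DegreeBelow (n ℕ.* d ℕ.+ d) (poly f ^ₚ d)
      f^d-below = below-mono (poly f ^ₚ d)
        (≡.subst (λ k → suc k ℕ.≤ n ℕ.* d ℕ.+ d) (ℕₚ.*-comm n d)
          (≡.subst (ℕ._≤ n ℕ.* d ℕ.+ d) (ℕₚ.+-comm (n ℕ.* d) 1) (ℕₚ.+-monoʳ-≤ (n ℕ.* d) (ℕ.>-nonZero⁻¹ d {{degree≢0 (Φ j)}}))))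
        (below (leading-^ (poly f) (leading-monic f) d))
      digits : w ν′ (poly f ^ₚ d) ≤⁺ w ν (poly f ^ₚ d) +∞ n · [ λⱼ ]
      digits = digitwise-≤ ν′ ν (Φ j) (ψ-expands (suc j)) (λ a ba → ≤⁺-reflexive (augmented-below j a ba))
        λⱼ (ℚₚ.<⇒≤ (λ-positive chain j)) (≤⁺-reflexive (augmented-Φ j)) n (poly f ^ₚ d) f^d-below

    F-slope : ∀ i → slope (νs i) (ψ i) ≤⁺ slope (νs i) F
    F-slope = >-weakInduction _
      (≡.subst (λ f → slope (νs top-index) (ψ top-index) ≤⁺ slope (νs top-index) f) nextKey-top
        (slope-≤-nextKey top-index (ψ top-index)))
      (λ j → maximal-slope-descends j F)

    -- Descending to the Gauss valuation, the slope of f is at least that of x, which is 0. Hence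
    -- the minimum of the coefficient values of f is not negative.
    maximal-slope⇒integral : ∀ f i → slope (νs i) (ψ i) ≤⁺ slope (νs i) f → IntegralPoly (poly f)
    maximal-slope⇒integral f = <-weakInduction _ base (λ j rec slopes → rec (maximal-slope-descends j f slopes))
      where
      base : slope (νs zero) X ≤⁺ slope (νs zero) f → IntegralPoly (poly f)
      base slopes = gauss-integral (μs chain zero) (start chain) (poly f) (≡.subst₂ _≤⁺_
        (≡.trans (≡.cong (degree f ·_) (gauss-X (μs chain zero) (start chain))) (·-zeroʳ (degree f)))
        (+∞-identityʳ _)
        (/∞-≤⇒cross 1 (degree f) {{_}} {{degree≢0 f}} slopes))

    nextKey-integral : ∀ i → IntegralPoly (poly (nextKey i))
    nextKey-integral i = maximal-slope⇒integral (nextKey i) i (slope-≤-nextKey i (ψ i))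

    degree-Φ<F : ∀ j → degree (Φ j) ℕ.< degree F
    degree-Φ<F = bound chain optimal strong
      where
      -- The length is a variable again here, so that matching on it unfolds `IsStrong`.
      bound : ∀ {r} (chain : MacLaneChain μ r) → IsOptimal chain → IsStrong chain F →
              ∀ j → degree (lookup (φs chain) j) ℕ.< degree F
      bound {suc _} chain optimal strong j =
        ℕₚ.≤-<-trans (increasing⇒≤last degree (φs chain) optimal j) strong

    nextKey-increasing : ∀ i j → i Fin.< j → degree (nextKey i) ℕ.< degree (nextKey j)
    nextKey-increasing i j i<j with view i | view j
    ... | ‵fromℕ | _ = contradiction (ℕₚ.≤-<-trans (Finₚ.≤fromℕ j) i<j) (ℕₚ.<-irrefl refl)
    ... | ‵inject₁ i | ‵fromℕ = ≡.subst₂ (λ f g → degree f ℕ.< degree g)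
          (≡.sym (nextKey-inject₁ i)) (≡.sym nextKey-top) (degree-Φ<F i)
    ... | ‵inject₁ i | ‵inject₁ j = ≡.subst₂ (λ f g → degree f ℕ.< degree g)
          (≡.sym (nextKey-inject₁ i)) (≡.sym (nextKey-inject₁ j))
          (optimal i j (≡.subst₂ ℕ._<_ (Finₚ.toℕ-inject₁ i) (Finₚ.toℕ-inject₁ j) i<j))

    Φ-below : ∀ j → DegreeBelow (degree (nextKey (suc j))) (poly (Φ j))
    Φ-below j = below-mono (poly (Φ j))
      (≡.subst (λ f → degree f ℕ.< degree (nextKey (suc j))) (nextKey-inject₁ j)
        (nextKey-increasing (inject₁ j) (suc j) (ℕₚ.≤-reflexive (≡.cong suc (Finₚ.toℕ-inject₁ j)))))
      (coeff-above (Φ j))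

    frameSeq≡ : ∀ i → frameSeq (φs chain) F̂ i ≡ mapMonic ι̂ (nextKey i)
    frameSeq≡ i = ≡.trans (≡.cong (λ fs → lookup fs i) (≡.sym (Vecₚ.map-∷ʳ (mapMonic ι̂) F (φs chain))))
      (Vecₚ.lookup-map i (mapMonic ι̂) (φs chain ∷ʳ F))

    private
      ψ-top-slope : ∃[ C ] slope (νs top-index) (ψ top-index) ≡ [ C ]
      ψ-top-slope = _ , ≡.cong (_/deg ψ top-index) (proj₂ (νs-finite top-index (ψ top-index)))

    -- By `slope-atθ-≤` this number bounds v(g(θ)) / deg g for all monic g over K of positive degree
    -- less than deg F.
    max-slope : ℚ
    max-slope = proj₁ ψ-top-slope

    max-slope≡ : slope (νs top-index) (ψ top-index) ≡ [ max-slope ]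
    max-slope≡ = proj₂ ψ-top-slope

    -- The pseudo-valuation g ↦ v(g(θ))

    module _ (θ : Field.Carrier K̄) (root : IsRoot ῑ (Polynomial.poly F̂) θ) where
      private
        ῑι̂ = compose ι̂ ῑ

      atθ : PseudoValuation
      atθ = evaluation ῑι̂ v̄ (λ a → ≡.trans (v̄-extends _) (IsCompletion.extends isCompletion a)) θ

      valAt≡ : ∀ g → valAt θ (mapPoly ι̂ g) ≡ w atθ g
      valAt≡ g = ≡.cong (val v̄) (eval-compose ι̂ ῑ g θ)

      atθ-F : w atθ (poly F) ≡ ∞
      atθ-F = ≡.trans (≡.sym (valAt≡ (poly F))) (≡.trans (Valuation.val-cong v̄ root) (Valuation.val-0 v̄))

      -- Induction along the chain. In degrees less than deg φᵢ, μᵢ agrees with its predecessor, or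
      -- with v on constants if i = 0. The remaining comparison at φᵢ is `φ-dominated`, which uses
      -- F(θ) = 0.
      νs-≤-atθ : ∀ i g → w (νs i) g ≤⁺ w atθ g
      νs-≤-atθ = <-weakInduction _
        (step zero λ a ba → ≤⁺-reflexive (≡.trans (constant (νs zero) a ba) (≡.sym (constant atθ a ba))))
        (λ j rec → step (suc j) λ a ba → ≡.subst (_≤⁺ w atθ a) (≡.sym (augmented-below j a ba)) (rec a))
        where
        step : ∀ i → (∀ a → DegreeBelow (degree (ψ i)) a → w (νs i) a ≤⁺ w atθ a) → ∀ g → w (νs i) g ≤⁺ w atθ g
        step i digits = dominates (νs i) atθ (ψ i) (ψ-expands i) digits
          (φ-dominated (νs i) atθ (ψ i) (ψ-expands i) digits F (νs-finite i (ψ i)) (F-slope i) atθ-F)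
        constant : ∀ ρ a → DegreeBelow 1 a → w ρ a ≡ val v (coeff a 0)
        constant ρ a ba = ≡.trans (w-cong ρ (constant-≋ a ba)) (w-const ρ (coeff a 0))

      -- At the top, μ(F) is finite while F(θ) = 0. Below the top, the next augmentation raises the
      -- value of its key polynomial by a positive λ and still lies below evaluation at θ.
      nextKey-< : ∀ i → w (νs i) (poly (nextKey i)) <⁺ w atθ (poly (nextKey i))
      nextKey-< i with view i
      ... | ‵fromℕ     = ≡.subst (λ f → w (νs top-index) (poly f) <⁺ w atθ (poly f)) (≡.sym nextKey-top)
            (let p , e = νs-finite top-index F in ≡.subst₂ _<⁺_ (≡.sym e) (≡.sym atθ-F) [ p ]<⊤)
      ... | ‵inject₁ j = ≡.subst (λ f → w (νs (inject₁ j)) (poly f) <⁺ w atθ (poly f)) (≡.sym (nextKey-inject₁ j))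
            (<⁺-≤⁺-trans
              (let p , e = νs-finite (inject₁ j) (Φ j) in
               ≡.subst (λ γ → γ <⁺ γ +∞ [ lookup (λs chain) j ]) (≡.sym e) (<⁺-+∞ʳ p (λ-positive chain j)))
              (≡.subst (_≤⁺ w atθ (poly (Φ j))) (augmented-Φ j) (νs-≤-atθ (suc j) (poly (Φ j)))))

      atθ≡νs : ∀ i g → DegreeBelow (degree (nextKey i)) g → w atθ g ≡ w (νs i) g
      atθ≡νs i = agree-below (νs i) atθ (νs-≤-atθ i) (restriction-definite (μs chain i))
        (nextKey i) (nextKey-keyLike i) (nextKey-< i)

      atθ-Φ : ∀ j → slope atθ (Φ j) ≡ slope (νs (suc j)) (Φ j)
      atθ-Φ j = ≡.cong (_/deg Φ j) (atθ≡νs (suc j) (poly (Φ j)) (Φ-below j))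

      slope-atθ-≤ : ∀ i g → degree g ℕ.< degree (nextKey i) → slope atθ g ≤⁺ slope (νs i) (ψ i)
      slope-atθ-≤ i g lt = ≡.subst (_≤⁺ slope (νs i) (ψ i))
        (≡.cong (_/deg g) (≡.sym (atθ≡νs i (poly g) (below-mono (poly g) lt (coeff-above g)))))
        (slope-≤-ψ i g)

      slope-nextKey-< : ∀ i → slope (νs i) (ψ i) <⁺ slope atθ (nextKey i)
      slope-nextKey-< i = ≤⁺-<⁺-trans (slope-≤-nextKey i (ψ i))
        (/∞-mono-< (degree (nextKey i)) {{degree≢0 (nextKey i)}} (nextKey-< i))

      okutsuC-suc : ∀ i → okutsuC (φs chain) F̂ θ (suc i) ≡ slope atθ (nextKey i)
      okutsuC-suc i = ≡.trans (≡.cong (λ G → Polynomial._/deg_ K̂ (valAt θ (Polynomial.poly G)) G) (frameSeq≡ i))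
        (≡.cong (_/deg nextKey i) (valAt≡ (poly (nextKey i))))

      okutsuC-Φ : ∀ j → okutsuC (φs chain) F̂ θ (suc (inject₁ j)) ≡ slope (νs (suc j)) (Φ j)
      okutsuC-Φ j = ≡.trans (okutsuC-suc (inject₁ j))
        (≡.trans (≡.cong (slope atθ) (nextKey-inject₁ j)) (atθ-Φ j))

      -- The convention C₀ = 0 fits in as the slope of x at the Gauss valuation.
      okutsuC-inject₁ : ∀ i → okutsuC (φs chain) F̂ θ (inject₁ i) ≡ slope (νs i) (ψ i)
      okutsuC-inject₁ zero    = ≡.sym (≡.cong (λ γ → γ /∞ 1) (gauss-X (μs chain zero) (start chain)))
      okutsuC-inject₁ (suc j) = okutsuC-Φ j

      -- Approximation of polynomials over K̂ by polynomials over K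

      open Valuation v̄ using () renaming (val-+ to v̄-+; val-* to v̄-*; val-cong to v̄-cong; val-0 to v̄-0)

      θ-integral : Valuation.Integral v̄ θ
      θ-integral = ≡.subst₂ _≤⁺_ (gauss-X (μs chain zero) (start chain)) (v̄-cong evalX) (νs-≤-atθ zero (poly X))
        where
        module ῑι̂ = FieldHom ῑι̂
        evalX : eval ῑι̂ (poly X) θ K̄.≈ θ
        evalX = K̄.begin
          ῑι̂.⟦ K.0# ⟧ K̄.+ θ K̄.* (ῑι̂.⟦ K.1# ⟧ K̄.+ θ K̄.* K̄.0#)
            K̄.≈⟨ K̄.+-cong ῑι̂.0#-homo (K̄.*-congˡ (K̄.+-cong ῑι̂.1#-homo (K̄.zeroʳ θ))) ⟩
          K̄.0# K̄.+ θ K̄.* (K̄.1# K̄.+ K̄.0#)      K̄.≈⟨ K̄.+-identityˡ _ ⟩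
          θ K̄.* (K̄.1# K̄.+ K̄.0#)                K̄.≈⟨ K̄.*-congˡ (K̄.+-identityʳ K̄.1#) ⟩
          θ K̄.* K̄.1#                            K̄.≈⟨ K̄.*-identityʳ θ ⟩
          θ                                      K̄.∎

      -- All coefficients below the leading 1 are replaced by nearby elements of K. As θ is
      -- integral, multiplication by θ in the Horner scheme does not enlarge the error.
      approximate : ∀ B k p → K̂ₚ.Leading p k K̂.1# →
                    ∃[ g ] Leading g k K.1# × ([ B ] ≤⁺ val v̄ (eval ῑι̂ g θ K̄.- eval ῑ p θ))
      approximate B zero p lp = 1ₚ , leading-const K.1# ,
        ≡.subst ([ B ] ≤⁺_) (≡.sym (≡.trans (v̄-cong difference) v̄-0)) (_ ≤⊤)
        where
        p≈1 : p K̂ₚ.≈ₚ K̂ₚ.1ₚ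
        p≈1 zero    = K̂ₚ.top lp
        p≈1 (suc i) = K̂ₚ.below lp (suc i) (ℕ.s≤s ℕ.z≤n)
        difference : eval ῑι̂ 1ₚ θ K̄.- eval ῑ p θ K̄.≈ K̄.0#
        difference = K̄.x≈y⇒x∙y⁻¹≈ε (K̄.trans (eval-1 ῑι̂ θ) (K̄.sym (K̄.trans (eval-cong ῑ p K̂ₚ.1ₚ θ p≈1) (eval-1 ῑ θ))))
      approximate B (suc k) []      lp = contradiction (K̂.sym (K̂ₚ.top lp)) (Field.1≉0 K̂)
      approximate B (suc k) (a ∷ p) lp
        with approximate B k p (K̂ₚ.top lp K̂ₚ., λ i le → K̂ₚ.below lp (suc i) (ℕ.s≤s le)) | IsCompletion.dense isCompletion a B
      ... | g , lg , g-close | b , b-close = b ∷ g ,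
            (top lg , λ { (suc i) (ℕ.s≤s le) → below lg i le }) ,
            ≡.subst ([ B ] ≤⁺_) (v̄-cong regroup) (≤⁺-trans
              (⊓∞-elim ([ B ] ≤⁺_) constant-close
                (≡.subst ([ B ] ≤⁺_) (≡.sym (v̄-* θ (G K̄.- P))) (≡.subst (_≤⁺ val v̄ θ +∞ val v̄ (G K̄.- P))
                  (+∞-identityˡ [ B ]) (+∞-mono-≤ θ-integral g-close))))
              (v̄-+ (b̄ K̄.- ā) (θ K̄.* (G K̄.- P))))
        where
        ā = FieldHom.⟦_⟧ ῑ a
        b̄ = FieldHom.⟦_⟧ ῑι̂ b
        G = eval ῑι̂ g θ
        P = eval ῑ p θ
        constant-close : [ B ] ≤⁺ val v̄ (b̄ K̄.- ā)
        constant-close = ≡.subst ([ B ] ≤⁺_) (begin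
          val v̂ (a K̂.- FieldHom.⟦_⟧ ι̂ b)                      ≡⟨ v̄-extends _ ⟨
          val v̄ (FieldHom.⟦_⟧ ῑ (a K̂.- FieldHom.⟦_⟧ ι̂ b))     ≡⟨ v̄-cong (K̄.trans (FieldHom.+-homo ῑ _ _) (K̄.+-congˡ (FieldHom.-‿homo ῑ _))) ⟩
          val v̄ (ā K̄.- b̄)                                     ≡⟨ ValuationProperties.val-neg v̄ (ā K̄.- b̄) ⟨
          val v̄ (K̄.- (ā K̄.- b̄))                               ≡⟨ v̄-cong (K̄.⁻¹-anti-homo-// ā b̄) ⟩
          val v̄ (b̄ K̄.- ā)                                     ∎) b-close
          where open ≡.≡-Reasoning
        regroup : (b̄ K̄.- ā) K̄.+ θ K̄.* (G K̄.- P) K̄.≈ (b̄ K̄.+ θ K̄.* G) K̄.- (ā K̄.+ θ K̄.* P)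
        regroup = K̄.begin
          (b̄ K̄.- ā) K̄.+ θ K̄.* (G K̄.- P)                       K̄.≈⟨ K̄.+-congˡ (K̄.x[y-z]≈xy-xz θ G P) ⟩
          (b̄ K̄.- ā) K̄.+ (θ K̄.* G K̄.- θ K̄.* P)                 K̄.≈⟨ K̄.+-assoc b̄ (K̄.- ā) _ ⟩
          b̄ K̄.+ (K̄.- ā K̄.+ (θ K̄.* G K̄.- θ K̄.* P))             K̄.≈⟨ K̄.+-congˡ (K̄.+-assoc (K̄.- ā) (θ K̄.* G) _) ⟨
          b̄ K̄.+ ((K̄.- ā K̄.+ θ K̄.* G) K̄.- θ K̄.* P)             K̄.≈⟨ K̄.+-congˡ (K̄.+-congʳ (K̄.+-comm (K̄.- ā) (θ K̄.* G))) ⟩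
          b̄ K̄.+ ((θ K̄.* G K̄.- ā) K̄.- θ K̄.* P)                 K̄.≈⟨ K̄.+-congˡ (K̄.+-assoc (θ K̄.* G) (K̄.- ā) _) ⟩
          b̄ K̄.+ (θ K̄.* G K̄.+ (K̄.- ā K̄.- θ K̄.* P))             K̄.≈⟨ K̄.+-assoc b̄ (θ K̄.* G) _ ⟨
          (b̄ K̄.+ θ K̄.* G) K̄.+ (K̄.- ā K̄.- θ K̄.* P)             K̄.≈⟨ K̄.+-congˡ (K̄.-‿+-comm ā (θ K̄.* P)) ⟩
          (b̄ K̄.+ θ K̄.* G) K̄.- (ā K̄.+ θ K̄.* P)                 K̄.∎

      -- A monic g ∈ K[x] close to G would have v(g(θ)) arbitrarily large,
      -- whereas v(g(θ)) = μ(g) is bounded in terms of the degree.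
      no-smaller-annihilator : ∀ (G : MonicPoly K̂) → Polynomial.degree G ℕ.< degree F →
                               ¬ IsRoot ῑ (Polynomial.poly G) θ
      no-smaller-annihilator G G<F G[θ]≈0
        with approximate (proj₁ n[C+1]) n (Polynomial.poly G) (K̂ₚ.leading-monic G)
        where
        n = Polynomial.degree G
        -- With this precision g has slope at least `max-slope` + 1 at θ, because G(θ) = 0.
        n[C+1] = ·-finite n (max-slope ℚ.+ 1ℚ)
      ... | g , lg , g-close = contradiction
            (<⁺-≤⁺-trans (<⁺-+∞ʳ {1ℚ} max-slope (ℚₚ.positive⁻¹ 1ℚ)) (≤⁺-trans lower upper)) <⁺-irrefl
        where
        n = Polynomial.degree G
        instance
          n≢0 : NonZero n
          n≢0 = Polynomial.degree≢0 G
        monic-g : MonicPoly K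
        monic-g = record { poly = g ; degree = n ; degree≢0 = n≢0 ; coeff-degree = top lg ; coeff-above = below lg }
        upper : slope atθ monic-g ≤⁺ [ max-slope ]
        upper = ≡.subst (slope atθ monic-g ≤⁺_) max-slope≡
          (slope-atθ-≤ top-index monic-g (≡.subst (λ f → n ℕ.< degree f) (≡.sym nextKey-top) G<F))
        lower : [ max-slope ℚ.+ 1ℚ ] ≤⁺ slope atθ monic-g
        lower = ·-cancel-≤ n (≡.subst₂ _≤⁺_ (≡.sym (proj₂ (·-finite n (max-slope ℚ.+ 1ℚ))))
          (≡.trans (v̄-cong (K̄.trans (K̄.+-congˡ (K̄.trans (K̄.-‿cong G[θ]≈0) K̄.-0#≈0#)) (K̄.+-identityʳ _)))
            (≡.sym (·-/∞ n (w atθ g)))) g-close)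

    -- Irreducibility over the completion

    root-of : ∀ (G : MonicPoly K̂) → ∃[ θ ] IsRoot ῑ (K̂ₚ.poly G) θ
    root-of G = let θ , e = IsAlgebraicClosure.closed isAlgebraicClosure (mapMonic ῑ G) in
      θ , K̄.trans (K̄.reflexive (≡.sym (eval-compose ῑ (idHom K̄) (K̂ₚ.poly G) θ))) e

    constant-∣-1 : ∀ p {a} → a K̂.≉ K̂.0# → K̂ₚ.Leading p 0 a →
                   RawSemiringDefinitions._∣_ (RawRing.rawSemiring K̂ₚ.polyRawRing) p K̂ₚ.1ₚ
    constant-∣-1 p {a} a≉0 lp = let b , ab≈1 = Field.invertible K̂ a a≉0 in record
      { quotient = b ∷ []
      ; equality = λ
        { zero    → K̂.trans (K̂ₚ.top-* (b ∷ []) p (K̂ₚ.leading-const b) lp) (K̂.trans (K̂.*-comm b a) ab≈1)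
        ; (suc i) → K̂ₚ.below (K̂ₚ.leading-* (b ∷ []) p (K̂ₚ.leading-const b) lp) (suc i) (ℕ.s≤s ℕ.z≤n)
        }
      }

    F̂-irreducible : K̂ₚ.Irreducible (K̂ₚ.poly F̂)
    F̂-irreducible = RawSemiringDefinitions.mkIrred not-unit split
      where
      f̂ = K̂ₚ.poly F̂
      n = degree F

      not-unit : ¬ RawSemiringDefinitions._∣_ (RawRing.rawSemiring K̂ₚ.polyRawRing) f̂ K̂ₚ.1ₚ
      not-unit record { quotient = q ; equality = qf≈1 } = let θ , root = root-of F̂ in
        contradiction (K̄.begin
          K̄.1#                               K̄.≈⟨ eval-1 ῑ θ ⟨
          eval ῑ K̂ₚ.1ₚ θ                     K̄.≈⟨ eval-cong ῑ (q K̂ₚ.*ₚ f̂) K̂ₚ.1ₚ θ qf≈1 ⟨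
          eval ῑ (q K̂ₚ.*ₚ f̂) θ               K̄.≈⟨ eval-* ῑ q f̂ θ ⟩
          eval ῑ q θ K̄.* eval ῑ f̂ θ          K̄.≈⟨ K̄.*-congˡ root ⟩
          eval ῑ q θ K̄.* K̄.0#                K̄.≈⟨ K̄.zeroʳ _ ⟩
          K̄.0#                               K̄.∎) (Field.1≉0 K̄)

      -- The factor p is made monic and θ is chosen as one of its roots. Then θ is also a root of F,
      -- so no annihilator of θ has degree less than n.
      no-proper-factor : ∀ p q k {a} → a K̂.≉ K̂.0# → K̂ₚ.Leading p k a → {{_ : NonZero k}} →
                         f̂ K̂ₚ.≈ₚ p K̂ₚ.*ₚ q → ¬ k ℕ.< n
      no-proper-factor p q k {a} a≉0 lp {{k≢0}} f≈pq k<n with Field.invertible K̂ a a≉0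
      ... | b , ab≈1 = no-smaller-annihilator θ F-root G k<n (proj₂ (root-of G))
        where
        G : MonicPoly K̂
        G = record
          { poly         = (b ∷ []) K̂ₚ.*ₚ p
          ; degree       = k
          ; degree≢0     = k≢0
          ; coeff-degree = K̂.trans (K̂ₚ.top lG) (K̂.trans (K̂.*-comm b a) ab≈1)
          ; coeff-above  = K̂ₚ.below lG
          }
          where
          lG = K̂ₚ.leading-* (b ∷ []) p (K̂ₚ.leading-const b) lp
        θ = proj₁ (root-of G)
        p[θ] = eval ῑ p θ
        module ῑ = FieldHom ῑ
        p-root : p[θ] K̄.≈ K̄.0#
        p-root = K̄.begin
          p[θ]                                             K̄.≈⟨ K̄.*-identityˡ _ ⟨
          K̄.1# K̄.* p[θ]                                    K̄.≈⟨ K̄.*-congʳ (K̄.trans (ῑ.⟦⟧-cong ab≈1) ῑ.1#-homo) ⟨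
          ῑ.⟦ a K̂.* b ⟧ K̄.* p[θ]                           K̄.≈⟨ K̄.*-congʳ (ῑ.*-homo a b) ⟩
          ῑ.⟦ a ⟧ K̄.* ῑ.⟦ b ⟧ K̄.* p[θ]                     K̄.≈⟨ K̄.*-assoc _ _ _ ⟩
          ῑ.⟦ a ⟧ K̄.* (ῑ.⟦ b ⟧ K̄.* p[θ])                   K̄.≈⟨ K̄.*-congˡ (K̄.*-congʳ (K̄.trans (K̄.+-congˡ (K̄.zeroʳ θ)) (K̄.+-identityʳ _))) ⟨
          ῑ.⟦ a ⟧ K̄.* (eval ῑ (b ∷ []) θ K̄.* p[θ])         K̄.≈⟨ K̄.*-congˡ (eval-* ῑ (b ∷ []) p θ) ⟨
          ῑ.⟦ a ⟧ K̄.* eval ῑ ((b ∷ []) K̂ₚ.*ₚ p) θ          K̄.≈⟨ K̄.*-congˡ (proj₂ (root-of G)) ⟩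
          ῑ.⟦ a ⟧ K̄.* K̄.0#                                 K̄.≈⟨ K̄.zeroʳ _ ⟩
          K̄.0#                                             K̄.∎
        F-root : IsRoot ῑ f̂ θ
        F-root = K̄.trans (eval-cong ῑ f̂ (p K̂ₚ.*ₚ q) θ f≈pq)
          (K̄.trans (eval-* ῑ p q θ) (K̄.trans (K̄.*-congʳ p-root) (K̄.zeroˡ _)))

      f̂-nonzero : ¬ K̂ₚ.DegreeBelow 0 f̂
      f̂-nonzero f≈0 = Field.1≉0 K̂ (K̂.trans (K̂.sym (K̂ₚ.coeff-degree F̂)) (f≈0 n ℕ.z≤n))

      split : ∀ {p q} → f̂ K̂ₚ.≈ₚ p K̂ₚ.*ₚ q → _ ⊎ _
      split {p} {q} f≈pq with K̂ₚ.vanishes⊎leading ≈0? p | K̂ₚ.vanishes⊎leading ≈0? q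
        where open ValuationProperties v̂ using (≈0?)
      ... | inj₁ p≈0 | _ = contradiction
            (K̂ₚ.below-cong (p K̂ₚ.*ₚ q) f̂ (λ i → K̂.sym (f≈pq i)) (K̂ₚ.*ₚ-vanishˡ p q p≈0)) f̂-nonzero
      ... | inj₂ _ | inj₁ q≈0 = contradiction
            (K̂ₚ.below-cong (p K̂ₚ.*ₚ q) f̂ (λ i → K̂.sym (f≈pq i)) (K̂ₚ.*ₚ-vanishʳ p q q≈0)) f̂-nonzero
      ... | inj₂ (zero , a , a≉0 , lp) | _ = inj₁ (constant-∣-1 p a≉0 lp)
      ... | inj₂ _ | inj₂ (zero , b , b≉0 , lq) = inj₂ (constant-∣-1 q b≉0 lq)
      ... | inj₂ (k@(suc _) , a , a≉0 , lp) | inj₂ (l@(suc _) , b , b≉0 , lq) =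
            contradiction (ℕₚ.<-≤-trans (ℕₚ.m<m+n k (ℕ.s≤s ℕ.z≤n)) k+l≤n) (no-proper-factor p q k a≉0 lp f≈pq)
        where
        ab≉0 : a K̂.* b K̂.≉ K̂.0#
        ab≉0 ab≈0 = let c , ac≈1 = Field.invertible K̂ a a≉0 in b≉0 (K̂.begin
          b                    K̂.≈⟨ K̂.*-identityˡ b ⟨
          K̂.1# K̂.* b           K̂.≈⟨ K̂.*-congʳ (K̂.trans (K̂.*-comm c a) ac≈1) ⟨
          c K̂.* a K̂.* b        K̂.≈⟨ K̂.*-assoc c a b ⟩
          c K̂.* (a K̂.* b)      K̂.≈⟨ K̂.*-congˡ ab≈0 ⟩
          c K̂.* K̂.0#           K̂.≈⟨ K̂.zeroʳ c ⟩
          K̂.0#                 K̂.∎)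
        -- The coefficient of the product at k + l is a b, which is not zero, whereas the
        -- coefficients of F beyond n vanish.
        k+l≤n : k ℕ.+ l ℕ.≤ n
        k+l≤n = ℕₚ.≮⇒≥ λ n<k+l → ab≉0 (K̂.begin
          a K̂.* b                          K̂.≈⟨ K̂ₚ.top-* p q lp lq ⟨
          K̂ₚ.coeff (p K̂ₚ.*ₚ q) (k ℕ.+ l)   K̂.≈⟨ f≈pq (k ℕ.+ l) ⟨
          K̂ₚ.coeff f̂ (k ℕ.+ l)             K̂.≈⟨ K̂ₚ.coeff-above F̂ (k ℕ.+ l) n<k+l ⟩
          K̂.0#                             K̂.∎)

    F̂-prime : IsPrimePoly F̂
    F̂-prime = record
      { integral    = λ n → ≡.subst ([ 0ℚ ] ≤⁺_)
          (≡.trans (≡.sym (IsCompletion.extends isCompletion _)) (≡.sym (Valuation.val-cong v̂ (coeff-map ι̂ (poly F) n))))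
          (≡.subst (λ f → IntegralPoly (poly f)) nextKey-top (nextKey-integral top-index) n)
      ; irreducible = F̂-irreducible
      }

    isOkutsuFrame : IsOkutsuFrame (φs chain) F̂
    isOkutsuFrame = record
      { F-prime    = F̂-prime
      ; integral   = λ i → ≡.subst (λ f → IntegralPoly (poly f)) (nextKey-inject₁ i) (nextKey-integral (inject₁ i))
      ; increasing = λ i j i<j → ≡.subst₂ ℕ._<_ (≡.sym (frame-degree i)) (≡.sym (frame-degree j)) (nextKey-increasing i j i<j)
      ; C-strict   = λ θ root i → ≡.subst₂ _<⁺_
          (≡.sym (okutsuC-inject₁ θ root i)) (≡.sym (okutsuC-suc θ root i)) (slope-nextKey-< θ root i)
      ; C-bound    = λ θ root i g _ g<F → ≡.subst₂ _≤⁺_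
          (≡.sym (≡.cong (_/deg g) (valAt≡ θ root (poly g)))) (≡.sym (okutsuC-inject₁ θ root i))
          (slope-atθ-≤ θ root i g (≡.subst (degree g ℕ.<_) (frame-degree i) g<F))
      }
      where
      frame-degree : ∀ i → Polynomial.degree (frameSeq (φs chain) F̂ i) ≡ degree (nextKey i)
      frame-degree i = ≡.cong Polynomial.degree (frameSeq≡ i)

theorem6p9 : ∀ {c ℓ} (S : Setting c ℓ) → let open Theory S in
    (μ : 𝕍) (r : ℕ) (chain : MacLaneChain μ r) → IsOptimal chain →
    (F : MonicPoly K) → IsKeyPolynomial μ F → IsStrong chain F →
    IsOkutsuFrame (φs chain) (mapMonic ι̂ F) ×
    (∀ θ → IsRoot ῑ (Polynomial.poly (mapMonic ι̂ F)) θ →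
    ∀ (i : Fin r) → okutsuC (φs chain) (mapMonic ι̂ F) θ (suc (inject₁ i)) ≡ Cμ chain i)
theorem6p9 S μ r chain optimal F keyF strong =
  isOkutsuFrame S chain optimal F keyF strong , okutsuC-Φ S chain optimal F keyF strong
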